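{- Let $p>3$ be a prime with $p\equiv 3\pmod 4$ and let $n\geq 1$ be an integer. Let $E$ be a supersingular elliptic curve over $\mathbb{F}_p$ with $j(E)\neq 1728$. Then there exists a twisting endomorphism $\alpha\in\operatorname{End}(E)$ of degree $n$ if and only if there exists an isogeny $\varphi:E\to E'$ of degree $n$ defined over $\mathbb{F}_p$ such that $E'$ is $\mathbb{F}_p$-isomorphic to the twist $E^t$ of $E$.
   Context: $\operatorname{End}(E)$ denotes the full (geometric) endomorphism ring of $E$ over $\overline{\mathbb{F}}_p$, and $\phi_{p,E}:(x,y)\mapsto(x^p,y^p)$ is the $p$-power Frobenius endomorphism of $E/\mathbb{F}_p$. A twisting endomorphism of a supersingular elliptic curve $E/\mathbb{F}_p$ is an $\alpha\in\operatorname{End}(E)$ with $\phi_{p,E}\circ\alpha=-\alpha\circ\phi_{p,E}$. For $E:y^2=x^3+ax+b$ over $\mathbb{F}_p$ with $j(E)\neq 1728$, the twist is $E^t:y^2=x^3+ax-b$. -}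

module Defs where

open import Level using (Level; suc; _⊔_)
open import Algebra.Bundles using (CommutativeRing)
open import Data.Empty.Polymorphic using (⊥)
open import Data.Unit.Polymorphic using (⊤; tt)
open import Data.Fin.Base as Fin using (Fin; toℕ; fromℕ; inject₁)
import Data.Fin.Properties as Fin
open import Data.List.Base using (List; []; _∷_)
open import Data.List.Relation.Unary.All using (All)
open import Data.Nat.Base as ℕ using (ℕ; zero; _<_; _∸_; _!)
import Data.Nat.Properties as ℕ
open import Data.Nat.Combinatorics using (_C_; nCn≡1; nCk≡n!/k![n-k]!; k![n∸k]!∣n!)
open import Data.Nat.DivMod using (m/n*n≡m)
open import Data.Nat.Divisibility using (_∣_; divides; m∣m*n; >⇒∤; ∣1⇒≡1)
open import Data.Nat.Primality using (Prime; prime⇒nonZero; prime⇒nonTrivial; euclidsLemma)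
open import Data.Product.Base using (∃; ∃₂; _×_; _,_)
open import Data.Sum.Base using (_⊎_; inj₁; inj₂)
open import Data.Vec.Base as Vec using (Vec; []; _∷_; lookup)
open import Function.Base using (_∘_)
open import Relation.Binary.Definitions using (Decidable)
open import Relation.Binary.PropositionalEquality as ≡ using (_≡_)
open import Relation.Nullary using (¬_; yes; no; contradiction)
open import Relation.Unary using (Pred; U)

module FieldNotation {c ℓ} (R : CommutativeRing c ℓ) where
  open CommutativeRing R public
  open import Algebra.Properties.Semiring.Exp semiring public using (_^_)
  open import Algebra.Properties.Semiring.Mult semiring public using () renaming (_×_ to _·_)
  open import Algebra.Properties.Semiring.Sum semiring public using (sum)

  -- In characteristic p the prime field 𝔽ₚ is the set of multiples of 1.
  𝔽ₚ : Pred Carrier ℓ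
  𝔽ₚ x = ∃ λ m → x ≈ m · 1#

record AlgebraicClosure (p : ℕ) (c ℓ : Level) : Set (suc (c ⊔ ℓ)) where
  field
    commutativeRing : CommutativeRing c ℓ

  open FieldNotation commutativeRing public

  field
    _≟_ : Decidable _≈_
    -- 0# ⁻¹ is left unspecified.
    _⁻¹ : Carrier → Carrier
    0≉1 : ¬ 0# ≈ 1#
    *-inverseʳ : ∀ x → ¬ x ≈ 0# → x * x ⁻¹ ≈ 1#
    characteristic : p · 1# ≈ 0#
    algebraicallyClosed : ∀ n (a : Fin (ℕ.suc n) → Carrier) →
      ∃ λ x → x ^ ℕ.suc n + sum (λ i → a i * x ^ toℕ i) ≈ 0#
    algebraic : ∀ x → ∃₂ λ n (a : Fin n → Carrier) →
      (∀ i → 𝔽ₚ (a i)) × x ^ n + sum (λ i → a i * x ^ toℕ i) ≈ 0#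

  infix 4 _≟_
  infix 9 _⁻¹

private
  p∤k! : ∀ {p} → Prime p → ∀ k → k < p → ¬ (p ∣ k !)
  p∤k! {p} pp zero    k<p p∣1 =
    ℕ.nonTrivial⇒≢1 {{prime⇒nonTrivial pp}} (∣1⇒≡1 p∣1)
  p∤k! {p} pp (ℕ.suc k) k<p p∣k! with euclidsLemma (ℕ.suc k) (k !) pp p∣k!
  ... | inj₁ p∣k  = >⇒∤ k<p p∣k
  ... | inj₂ p∣k! = p∤k! pp k (ℕ.<-trans (ℕ.n<1+n k) k<p) p∣k!

  p∣pCk : ∀ {p} → Prime p → ∀ k → 0 < k → k < p → p ∣ (p C k)
  p∣pCk {p} pp k 0<k k<p with euclidsLemma (p C k) (k ! ℕ.* (p ∸ k) !) pp p∣prod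
    where
    instance
      _ = prime⇒nonZero pp
      _ = k ℕ.!* (p ∸ k) !≢0
    prod≡p! : (p C k) ℕ.* (k ! ℕ.* (p ∸ k) !) ≡ p !
    prod≡p! = ≡.trans (≡.cong (ℕ._* (k ! ℕ.* (p ∸ k) !)) (nCk≡n!/k![n-k]! (ℕ.<⇒≤ k<p)))
                      (m/n*n≡m (k![n∸k]!∣n! (ℕ.<⇒≤ k<p)))
    p∣p! : ∀ n → .{{ℕ.NonZero n}} → n ∣ n !
    p∣p! (ℕ.suc n) = m∣m*n (n !)
    p∣prod : p ∣ (p C k) ℕ.* (k ! ℕ.* (p ∸ k) !)
    p∣prod = ≡.subst (p ∣_) (≡.sym prod≡p!) (p∣p! p)
  ... | inj₁ p∣C = p∣C
  ... | inj₂ p∣rest with euclidsLemma (k !) ((p ∸ k) !) pp p∣rest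
  ...   | inj₁ d = contradiction d (p∤k! pp k k<p)
  ...   | inj₂ d = contradiction d (p∤k! pp (p ∸ k) (ℕ.∸-monoʳ-< 0<k (ℕ.<⇒≤ k<p)))

module Curves {p : ℕ} {c ℓ : Level} (p-prime : Prime p) (K : AlgebraicClosure p c ℓ) where

  open AlgebraicClosure K
  open import Algebra.Properties.Ring ring using (-‿distribˡ-*; -‿distribʳ-*; -‿involutive; +-inverseʳ-unique)
  open import Algebra.Properties.Semiring.Mult semiring
    using (×-congˡ; ×-congʳ; ×-homo-+; ×-homo-1; ×1-homo-*; ×-assoc-*)
  open import Algebra.Properties.Semiring.Sum semiring
    using (sum-init-last; sum-cong-≋; sum-replicate-zero)
  open import Algebra.Properties.Semiring.Exp semiring using (^-congˡ; ^-assocʳ)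
  open import Algebra.Properties.CommutativeSemiring.Exp commutativeSemiring using (^-distrib-*)
  import Algebra.Properties.CommutativeSemiring.Binomial commutativeSemiring as Binomial
  open import Relation.Binary.Reasoning.Setoid setoid

  instance
    private
      p-nonZero : ℕ.NonZero p
      p-nonZero = prime⇒nonZero p-prime

  p∣n⇒n·x≈0 : ∀ {n} x → p ∣ n → n · x ≈ 0#
  p∣n⇒n·x≈0 {n} x (divides q n≡qp) = begin
    n · x                       ≈⟨ ×-congˡ n≡qp ⟩
    (q ℕ.* p) · x               ≈⟨ ×-congʳ (q ℕ.* p) (*-identityˡ x) ⟨
    (q ℕ.* p) · (1# * x)        ≈⟨ ×-assoc-* (q ℕ.* p) 1# x ⟨
    ((q ℕ.* p) · 1#) * x        ≈⟨ *-congʳ (×1-homo-* q p) ⟩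
    ((q · 1#) * (p · 1#)) * x   ≈⟨ *-congʳ (*-congˡ characteristic) ⟩
    ((q · 1#) * 0#) * x         ≈⟨ *-congʳ (zeroʳ _) ⟩
    0# * x                      ≈⟨ zeroˡ x ⟩
    0#                          ∎

  private
    middle-terms : ∀ {n} x y → n ≡ p → (k : Fin n) → 0 < toℕ k →
                   (p C toℕ k) · (x ^ toℕ k * y ^ (p ∸ toℕ k)) ≈ 0#
    middle-terms x y ≡.refl k 0<k = p∣n⇒n·x≈0 _ (p∣pCk p-prime (toℕ k) 0<k (Fin.toℕ<n k))

  ^p-homo-+ : ∀ x y → (x + y) ^ p ≈ x ^ p + y ^ p
  ^p-homo-+ x y = begin
    (x + y) ^ p                                         ≈⟨ Binomial.theorem p x y ⟩
    sum t                                               ≈⟨ sum-split p ≡.refl ⟩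
    t Fin.zero + t (fromℕ p)                            ≈⟨ +-cong first final ⟩
    y ^ p + x ^ p                                       ≈⟨ +-comm _ _ ⟩
    x ^ p + y ^ p                                       ∎
    where
    t : Fin (ℕ.suc p) → Carrier
    t = Binomial.binomialTerm x y p

    first : t Fin.zero ≈ y ^ p
    first = trans (×-homo-1 _) (*-identityˡ _)

    final : t (fromℕ p) ≈ x ^ p
    final = begin
      (p C toℕ (fromℕ p)) · (x ^ toℕ (fromℕ p) * y ^ (p ∸ toℕ (fromℕ p)))
        ≡⟨ ≡.cong (λ k → (p C k) · (x ^ k * y ^ (p ∸ k))) (Fin.toℕ-fromℕ p) ⟩
      (p C p) · (x ^ p * y ^ (p ∸ p))
        ≡⟨ ≡.cong₂ (λ k m → k · (x ^ p * y ^ m)) (nCn≡1 p) (ℕ.n∸n≡0 p) ⟩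
      1 · (x ^ p * 1#)   ≈⟨ ×-homo-1 _ ⟩
      x ^ p * 1#         ≈⟨ *-identityʳ _ ⟩
      x ^ p              ∎

    sum-split : ∀ n → n ≡ p → sum t ≈ t Fin.zero + t (fromℕ p)
    sum-split zero      0≡p = contradiction (≡.sym 0≡p) (ℕ.≢-nonZero⁻¹ p)
    sum-split (ℕ.suc n) ≡.refl = +-congˡ (begin
      sum (t ∘ Fin.suc)
        ≈⟨ sum-init-last (t ∘ Fin.suc) ⟩
      sum (t ∘ Fin.suc ∘ inject₁) + t (fromℕ p)
        ≈⟨ +-congʳ (sum-cong-≋ mid) ⟩
      sum {n} (λ _ → 0#) + t (fromℕ p)
        ≈⟨ +-congʳ (sum-replicate-zero n) ⟩
      0# + t (fromℕ p)
        ≈⟨ +-identityˡ _ ⟩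
      t (fromℕ p) ∎)
      where
      mid : ∀ i → t (Fin.suc (inject₁ i)) ≈ 0#
      mid i = trans (reflexive (≡.cong (λ k → (p C k) · (x ^ k * y ^ (p ∸ k)))
                                       (≡.cong ℕ.suc (Fin.toℕ-inject₁ i))))
                    (middle-terms x y ≡.refl (Fin.suc i) ℕ.z<s)

  1^n≈1 : ∀ n → 1# ^ n ≈ 1#
  1^n≈1 zero      = refl
  1^n≈1 (ℕ.suc n) = trans (*-identityˡ _) (1^n≈1 n)

  0^p≈0 : 0# ^ p ≈ 0#
  0^p≈0 = 0^n p
    where
    0^n : ∀ n → .{{ℕ.NonZero n}} → 0# ^ n ≈ 0#
    0^n (ℕ.suc n) = zeroˡ _

  𝔽ₚ-^p : ∀ {x} → 𝔽ₚ x → x ^ p ≈ x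
  𝔽ₚ-^p {x} (m , x≈m) = begin
    x ^ p          ≈⟨ ^-congˡ p x≈m ⟩
    (m · 1#) ^ p   ≈⟨ multiples m ⟩
    m · 1#         ≈⟨ x≈m ⟨
    x              ∎
    where
    multiples : ∀ m → (m · 1#) ^ p ≈ m · 1#
    multiples zero      = 0^p≈0
    multiples (ℕ.suc m) = trans (^p-homo-+ 1# (m · 1#)) (+-cong (1^n≈1 p) (multiples m))

  𝔽ₚ-neg : ∀ {x} → 𝔽ₚ x → 𝔽ₚ (- x)
  𝔽ₚ-neg {x} (m , x≈m) = ℕ.pred p ℕ.* m , sym (+-inverseʳ-unique x _ (begin
    x + (ℕ.pred p ℕ.* m) · 1#         ≈⟨ +-congʳ x≈m ⟩
    m · 1# + (ℕ.pred p ℕ.* m) · 1#    ≈⟨ ×-homo-+ 1# m (ℕ.pred p ℕ.* m) ⟨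
    (ℕ.suc (ℕ.pred p) ℕ.* m) · 1#     ≡⟨ ≡.cong (λ q → (q ℕ.* m) · 1#) (ℕ.suc-pred p) ⟩
    (p ℕ.* m) · 1#                    ≈⟨ p∣n⇒n·x≈0 1# (m∣m*n m) ⟩
    0#                                ∎))

  -x^2≈x^2 : ∀ x → (- x) ^ 2 ≈ x ^ 2
  -x^2≈x^2 x = begin
    - x * (- x * 1#)   ≈⟨ *-congˡ (*-identityʳ _) ⟩
    - x * - x          ≈⟨ -‿distribˡ-* x (- x) ⟨
    - (x * - x)        ≈⟨ -‿cong (-‿distribʳ-* x x) ⟨
    - (- (x * x))      ≈⟨ -‿involutive _ ⟩
    x * x              ≈⟨ *-congˡ (*-identityʳ _) ⟨
    x ^ 2              ∎

  -- y² = x³ + ax + b; for p > 3 every elliptic curve over 𝔽ₚ has such a model.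
  record EllipticCurve : Set (c ⊔ ℓ) where
    field
      a b : Carrier
      a∈𝔽ₚ : 𝔽ₚ a
      b∈𝔽ₚ : 𝔽ₚ b
      nonsingular : ¬ 4 · a ^ 3 + 27 · b ^ 2 ≈ 0#

  open EllipticCurve

  j : EllipticCurve → Carrier
  j E = 1728 · (4 · a E ^ 3) * (4 · a E ^ 3 + 27 · b E ^ 2) ⁻¹

  twist : EllipticCurve → EllipticCurve
  twist E = record
    { a = a E
    ; b = - b E
    ; a∈𝔽ₚ = a∈𝔽ₚ E
    ; b∈𝔽ₚ = 𝔽ₚ-neg (b∈𝔽ₚ E)
    ; nonsingular = λ Δ≈0 → nonsingular E
        (trans (+-congˡ (×-congʳ 27 (sym (-x^2≈x^2 (b E))))) Δ≈0)
    }

  data Pt : Set c where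
    O   : Pt
    aff : (x y : Carrier) → Pt

  data _≈ₚ_ : Pt → Pt → Set (c ⊔ ℓ) where
    O≈O : O ≈ₚ O
    aff : ∀ {x y x′ y′} → x ≈ x′ → y ≈ y′ → aff x y ≈ₚ aff x′ y′

  _∈ₚ_ : Pt → EllipticCurve → Set ℓ
  O       ∈ₚ E = ⊤
  aff x y ∈ₚ E = y ^ 2 ≈ x ^ 3 + a E * x + b E

  record Point (E : EllipticCurve) : Set (c ⊔ ℓ) where
    constructor _,_
    field
      pt      : Pt
      onCurve : pt ∈ₚ E

  open Point public

  -- Homogeneous coordinates in ℙ².
  coords : Pt → Vec Carrier 3
  coords O         = 0# ∷ 1# ∷ 0# ∷ []
  coords (aff x y) = x ∷ y ∷ 1# ∷ []

  negate : ∀ {E} → Point E → Point E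
  negate (O       , _) = O , tt
  negate (aff x y , e) = aff x (- y) , trans (-x^2≈x^2 y) e

  frobenius : ∀ {E} → Point E → Point E
  frobenius     (O       , _) = O , tt
  frobenius {E} (aff x y , e) = aff (x ^ p) (y ^ p) , (begin
    (y ^ p) ^ 2                              ≈⟨ swap y 2 ⟩
    (y ^ 2) ^ p                              ≈⟨ ^-congˡ p e ⟩
    (x ^ 3 + a E * x + b E) ^ p              ≈⟨ ^p-homo-+ _ _ ⟩
    (x ^ 3 + a E * x) ^ p + b E ^ p          ≈⟨ +-congʳ (^p-homo-+ _ _) ⟩
    (x ^ 3) ^ p + (a E * x) ^ p + b E ^ p    ≈⟨ +-cong (+-cong (sym (swap x 3)) (^-distrib-* (a E) x p))
                                                       (𝔽ₚ-^p (b∈𝔽ₚ E)) ⟩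
    (x ^ p) ^ 3 + a E ^ p * x ^ p + b E      ≈⟨ +-congʳ (+-congˡ (*-congʳ (𝔽ₚ-^p (a∈𝔽ₚ E)))) ⟩
    (x ^ p) ^ 3 + a E * x ^ p + b E          ∎)
    where
    swap : ∀ z n → (z ^ p) ^ n ≈ (z ^ n) ^ p
    swap z n = begin
      (z ^ p) ^ n      ≈⟨ ^-assocʳ z p n ⟩
      z ^ (p ℕ.* n)    ≡⟨ ≡.cong (z ^_) (ℕ.*-comm p n) ⟩
      z ^ (n ℕ.* p)    ≈⟨ ^-assocʳ z n p ⟨
      (z ^ n) ^ p      ∎

  -- The chord–tangent law of E in coordinates; only its values on points of E
  -- are meaningful.  In the tangent case y₁ = y₂ ≠ 0, so 2y₁ is invertible.
  add : EllipticCurve → Pt → Pt → Pt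
  add E O           Q           = Q
  add E P@(aff _ _) O           = P
  add E (aff x₁ y₁) (aff x₂ y₂) with x₁ ≟ x₂ | y₁ + y₂ ≟ 0#
  ... | no  _ | _     = let s = (y₂ - y₁) * (x₂ - x₁) ⁻¹
                            x₃ = s ^ 2 - x₁ - x₂
                        in aff x₃ (s * (x₁ - x₃) - y₁)
  ... | yes _ | yes _ = O
  ... | yes _ | no  _ = let s = (3 · x₁ ^ 2 + a E) * (2 · y₁) ⁻¹
                            x₃ = s ^ 2 - x₁ - x₂
                        in aff x₃ (s * (x₁ - x₃) - y₁)

  [_]_on_ : ℕ → Pt → EllipticCurve → Pt
  [ zero ]    P on E = O
  [ ℕ.suc m ] P on E = add E P ([ m ] P on E)

  -- E[p] = O over the algebraic closure.
  Supersingular : EllipticCurve → Set (c ⊔ ℓ)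
  Supersingular E = (P : Point E) → ([ p ] pt P on E) ≈ₚ O → pt P ≈ₚ O

  -- Formal sums of terms (coefficient , exponents).  They are only ever
  -- evaluated, so repeated monomials and zero coefficients do no harm.
  Poly : ℕ → Set c
  Poly n = List (Carrier × Vec ℕ n)

  monomial : ∀ {n} → Vec ℕ n → Vec Carrier n → Carrier
  monomial []       []       = 1#
  monomial (e ∷ es) (x ∷ xs) = x ^ e * monomial es xs

  eval : ∀ {n} → Poly n → Vec Carrier n → Carrier
  eval []             xs = 0#
  eval ((k , es) ∷ f) xs = k * monomial es xs + eval f xs

  Homogeneous : ∀ {n} → ℕ → Poly n → Set c
  Homogeneous d = All λ (_ , es) → Vec.sum es ≡ d

  CoefficientsIn : ∀ {n s} → Pred Carrier s → Poly n → Set (c ⊔ s)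
  CoefficientsIn S = All λ (k , _) → S k

  Vanishes : Vec (Poly 3) 3 → Pt → Set ℓ
  Vanishes F P = ∀ i → eval (lookup F i) (coords P) ≈ 0#

  -- [F₀(Q) : F₁(Q) : F₂(Q)] = R, given that F does not vanish at Q.
  _sends_to_ : Vec (Poly 3) 3 → Pt → Pt → Set (c ⊔ ℓ)
  F sends Q to R = ∃ λ u → ∀ i → eval (lookup F i) (coords Q) ≈ u * lookup (coords R) i

  -- The map is a morphism of projective curves defined over the subfield S:
  -- near each point it is given by forms of equal degree with coefficients in S.
  DefinedOver : ∀ {s} → Pred Carrier s → ∀ {E E′} → (Point E → Point E′) → Set (c ⊔ ℓ ⊔ s)
  DefinedOver S {E} φ = (P : Point E) → ∃₂ λ d (F : Vec (Poly 3) 3) →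
    (∀ i → Homogeneous d (lookup F i)) ×
    (∀ i → CoefficientsIn S (lookup F i)) ×
    ¬ Vanishes F (pt P) ×
    ((Q : Point E) → ¬ Vanishes F (pt Q) → F sends pt Q to pt (φ Q))

  -- Geometric isogenies; the zero map is included, so that Isogeny E E is End(E).
  record Isogeny (E E′ : EllipticCurve) : Set (c ⊔ ℓ) where
    field
      map      : Point E → Point E′
      morphism : DefinedOver U map
      map-O    : pt (map (O , tt)) ≈ₚ O

  open Isogeny public

  _≅𝔽ₚ_ : EllipticCurve → EllipticCurve → Set (c ⊔ ℓ)
  E ≅𝔽ₚ E′ = ∃₂ λ (f : Isogeny E E′) (g : Isogeny E′ E) →
    DefinedOver 𝔽ₚ (map f) × DefinedOver 𝔽ₚ (map g) ×
    (∀ P → pt (map g (map f P)) ≈ₚ pt P) × (∀ P → pt (map f (map g P)) ≈ₚ pt P)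

  Twisting : ∀ {E} → Isogeny E E → Set (c ⊔ ℓ)
  Twisting α = ∀ P → pt (frobenius (map α P)) ≈ₚ pt (negate (map α (frobenius P)))

  record RationalFunction (E : EllipticCurve) : Set (c ⊔ ℓ) where
    field
      num den : Poly 2
      den≉0   : ∃₂ λ x y → (aff x y ∈ₚ E) × ¬ eval den (x ∷ y ∷ []) ≈ 0#

  open RationalFunction

  -- The fraction has value z at the point.  A fraction has no value at O or where
  -- its denominator is zero: this excludes finitely many points, and two elements
  -- of the function field agreeing at all but finitely many points are equal.
  _at_↦_ : ∀ {E} → RationalFunction E → Pt → Carrier → Set ℓ
  f at O       ↦ z = ⊥
  f at aff x y ↦ z = (¬ eval (den f) (x ∷ y ∷ []) ≈ 0#) ×
                     eval (num f) (x ∷ y ∷ []) ≈ z * eval (den f) (x ∷ y ∷ [])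

  IsZero : ∀ {E} → RationalFunction E → Set (c ⊔ ℓ)
  IsZero {E} f = ∀ (Q : Point E) z → f at pt Q ↦ z → z ≈ 0#

  -- Pulling back along φ only makes sense for φ ≠ 0, whose fibres are finite, so that
  -- gᵢ ∘ φ has a value at all but finitely many points.
  module _ {E E′} (φ : Isogeny E E′) where

    -- Σ φ*(gᵢ) eᵢ = f in K(E), tested where all the fractions have values.
    Combination : ∀ {n} → (Fin n → RationalFunction E′) → (Fin n → RationalFunction E) →
                  RationalFunction E → Set (c ⊔ ℓ)
    Combination {n} g e f = ∀ (Q : Point E) (v w : Fin n → Carrier) z →
      (∀ i → g i at pt (map φ Q) ↦ v i) → (∀ i → e i at pt Q ↦ w i) → f at pt Q ↦ z →
      sum (λ i → v i * w i) ≈ z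

    Relation : ∀ {n} → (Fin n → RationalFunction E′) → (Fin n → RationalFunction E) →
               Set (c ⊔ ℓ)
    Relation {n} g e = ∀ (Q : Point E) (v w : Fin n → Carrier) →
      (∀ i → g i at pt (map φ Q) ↦ v i) → (∀ i → e i at pt Q ↦ w i) →
      sum (λ i → v i * w i) ≈ 0#

    -- e is a basis of K(E) over φ*K(E′).
    IsBasis : ∀ {n} → (Fin n → RationalFunction E) → Set (c ⊔ ℓ)
    IsBasis e = (∀ f → ∃ λ g → Combination g e f) ×
                (∀ g → Relation g e → ∀ i → IsZero (g i))

    -- deg φ = [K(E) : φ*K(E′)] for φ ≠ 0, and deg 0 = 0.
    HasDegree : ℕ → Set (c ⊔ ℓ)
    HasDegree n =
        (n ≡ 0 × ∀ P → pt (map φ P) ≈ₚ O)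
      ⊎ ((∃ λ P → ¬ pt (map φ P) ≈ₚ O) × (∃ λ (e : Fin n → RationalFunction E) → IsBasis e))

module Submission where

-- Fix i with i² = −1; since p ≡ 3 (mod 4), i^p = −i.  Hence the isomorphism
-- τ : E → Eᵗ, (x , y) ↦ (−x , i y), anticommutes with Frobenius, and α is twisting if
-- and only if τ ∘ α commutes with Frobenius.  Composing with an isomorphism does not
-- change the degree, so it remains to see that a morphism φ is defined over 𝔽ₚ if and
-- only if it commutes with Frobenius.  For the nontrivial direction, the coefficient
-- vectors of the triples of forms of given shape that represent φ make up a
-- Frobenius-stable K-subspace of Kᴺ, and such a subspace is spanned by its 𝔽ₚ-points.

open import Defs
open import Level using (Level; _⊔_) renaming (suc to lsuc)
open import Data.Fin.Base as Fin using (Fin; zero; suc; toℕ)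
open import Data.Fin.Properties as Fin using (any?; all?; toℕ<n; toℕ-injective; suc-injective)
open import Data.List.Base as List using (List; []; _∷_; _++_)
open import Data.List.Relation.Unary.All as All using (All; []; _∷_)
import Data.List.Relation.Unary.All.Properties as All
open import Data.Nat.Base as ℕ using (ℕ; zero; suc; _≤_; _<_; _>_; _≥_; _%_; s≤s; z≤n)
open import Data.Nat.Coprimality using (prime⇒coprime; coprime-Bézout)
import Data.Nat.DivMod as ℕ
open import Data.Nat.GCD using (module Bézout)
open import Data.Nat.Primality using (Prime; prime⇒nonTrivial)
import Data.Nat.Properties as ℕ
open import Data.Product.Base using (∃; ∃₂; _×_; _,_; proj₁; proj₂)
open import Data.Sum.Base using (inj₁; inj₂)
open import Data.Unit.Polymorphic using (tt)
open import Data.Vec.Base as Vec using (Vec; []; _∷_; lookup)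
open import Data.Vec.Properties using (lookup-map; lookup∘tabulate)
open import Function.Base using (_∘_; id)
open import Function.Bundles using (_⇔_; mk⇔)
open import Relation.Binary.PropositionalEquality as ≡ using (_≡_)
open import Relation.Nullary using (¬_; yes; no; contradiction)
open import Relation.Unary using (Pred; U)

-- `DefinedOver` is local: at each point it asks for forms that do not vanish there. One triple of
-- forms over 𝔽ₚ representing φ would therefore not be enough, and descent is used as a spanning
-- statement: if all rational triples in a linear combination vanished at P, so would the
-- combination. Since nonvanishing is not a linear condition, the subspace contains triples with
-- zeros (`sends-everywhere`), and nonvanishing at P is recovered only at the end. Degrees raise a
-- similar difficulty. A pulled-back function is a fraction built from forms chosen at one point;
-- each of its values is a value of the composite, but the converse is available at that point only.

module Twists {p : ℕ} {c ℓ : Level} (p-prime : Prime p) (K : AlgebraicClosure p c ℓ) where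

  open AlgebraicClosure K hiding (zero)
  open Curves p-prime K
  open import Algebra.Properties.Ring ring
  open import Algebra.Properties.Semiring.Mult semiring using (×1-homo-*; ×-congˡ)
  open import Algebra.Properties.Semiring.Sum semiring using (sum-cong-≋; sum-replicate-zero)
  open import Algebra.Properties.Semiring.Exp semiring using (^-congˡ; ^-homo-*; ^-assocʳ)
  open import Algebra.Properties.CommutativeSemiring.Exp commutativeSemiring using (^-distrib-*)
  open import Algebra.Solver.Ring.NaturalCoefficients.Default commutativeSemiring
    using (solve; _:=_; _:+_; _:*_; con)
  open import Relation.Binary.Reasoning.Setoid setoid

  -- Roots in K, and 𝔽ₚ as the fixed points of the p-th power

  p≥2 : 2 ≤ p
  p≥2 = ℕ.nonTrivial⇒n>1 p {{prime⇒nonTrivial p-prime}}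

  x*y≈0⇒y≈0 : ∀ {x y} → ¬ x ≈ 0# → x * y ≈ 0# → y ≈ 0#
  x*y≈0⇒y≈0 {x} {y} x≉0 xy≈0 = begin
    y               ≈⟨ *-identityˡ y ⟨
    1# * y          ≈⟨ *-congʳ (*-inverseʳ x x≉0) ⟨
    (x * x ⁻¹) * y  ≈⟨ solve 3 (λ x i y → (x :* i) :* y := i :* (x :* y)) refl x (x ⁻¹) y ⟩
    x ⁻¹ * (x * y)  ≈⟨ *-congˡ xy≈0 ⟩
    x ⁻¹ * 0#       ≈⟨ zeroʳ _ ⟩
    0#              ∎

  *-≉0 : ∀ {x y} → ¬ x ≈ 0# → ¬ y ≈ 0# → ¬ x * y ≈ 0#
  *-≉0 x≉0 y≉0 xy≈0 = y≉0 (x*y≈0⇒y≈0 x≉0 xy≈0)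

  ^-≉0 : ∀ {x} n → ¬ x ≈ 0# → ¬ x ^ n ≈ 0#
  ^-≉0 zero    x≉0 = 0≉1 ∘ sym
  ^-≉0 (suc n) x≉0 = *-≉0 x≉0 (^-≉0 n x≉0)

  ^≈0⇒≈0 : ∀ {x} n → x ^ n ≈ 0# → x ≈ 0#
  ^≈0⇒≈0 {x} n xⁿ≈0 with x ≟ 0#
  ... | yes x≈0 = x≈0
  ... | no  x≉0 = contradiction xⁿ≈0 (^-≉0 n x≉0)

  *-cancelˡ-≉0 : ∀ {x y z} → ¬ x ≈ 0# → x * y ≈ x * z → y ≈ z
  *-cancelˡ-≉0 {x} {y} {z} x≉0 xy≈xz = x∙y⁻¹≈ε⇒x≈y y z (x*y≈0⇒y≈0 x≉0
    (trans (x[y-z]≈xy-xz x y z) (x≈y⇒x∙y⁻¹≈ε xy≈xz)))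

  ^p-neg : ∀ x → (- x) ^ p ≈ - (x ^ p)
  ^p-neg x = +-inverseˡ-unique _ _ (begin
    (- x) ^ p + x ^ p  ≈⟨ ^p-homo-+ (- x) x ⟨
    (- x + x) ^ p      ≈⟨ ^-congˡ p (-‿inverseˡ x) ⟩
    0# ^ p             ≈⟨ 0^p≈0 ⟩
    0#                 ∎)

  ^p-injective : ∀ {x y} → x ^ p ≈ y ^ p → x ≈ y
  ^p-injective {x} {y} e = x∙y⁻¹≈ε⇒x≈y x y (^≈0⇒≈0 p (begin
    (x - y) ^ p        ≈⟨ ^p-homo-+ x (- y) ⟩
    x ^ p + (- y) ^ p  ≈⟨ +-cong e (^p-neg y) ⟩
    y ^ p - y ^ p      ≈⟨ -‿inverseʳ _ ⟩
    0#                 ∎))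

  -- One family serves all root extractions: Artin-Schreier roots (`n = p`, `e = 1`), p-th roots and
  -- the square root of -1 (`e = 0`). The bound on `n` keeps the term `e * x` below the leading one.
  trinomial-root : ∀ n → 2 ≤ n → ∀ e d → ∃ λ x → x ^ n ≈ e * x + d
  trinomial-root (suc (suc m)) (s≤s (s≤s z≤n)) e d with algebraicallyClosed (suc m) a
    where
    a : Fin (suc (suc m)) → Carrier
    a zero          = - d
    a (suc zero)    = - e
    a (suc (suc i)) = 0#
  ... | x , root = x , (begin
    x ^ suc (suc m)
      ≈⟨ +-inverseˡ-unique _ _ root ⟩
    - (- d * 1# + (- e * (x * 1#) + sum {m} (λ i → 0# * x ^ toℕ (suc (suc i)))))
      ≈⟨ -‿cong (+-congˡ (+-congˡ (trans (sum-cong-≋ {m} (λ i → zeroˡ _)) (sum-replicate-zero m)))) ⟩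
    - (- d * 1# + (- e * (x * 1#) + 0#))
      ≈⟨ -‿cong (+-cong (*-identityʳ _) (trans (+-identityʳ _) (*-congˡ (*-identityʳ x)))) ⟩
    - (- d + - e * x)
      ≈⟨ -‿cong (+-congˡ (-‿distribˡ-* e x)) ⟨
    - (- d - e * x)
      ≈⟨ -‿cong (-‿+-comm d (e * x)) ⟩
    - - (d + e * x)
      ≈⟨ -‿involutive _ ⟩
    d + e * x
      ≈⟨ +-comm _ _ ⟩
    e * x + d ∎)

  artinSchreier-root : ∀ d → ∃ λ x → x ^ p ≈ x + d
  artinSchreier-root d with trinomial-root p p≥2 1# d
  ... | x , root = x , trans root (+-congʳ (*-identityˡ x))

  pth-root : ∀ d → ∃ λ x → x ^ p ≈ d
  pth-root d with trinomial-root p p≥2 0# d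
  ... | x , root = x , trans root (trans (+-congʳ (zeroˡ x)) (+-identityˡ d))

  i²≈-1 : ∃ λ i → i ^ 2 ≈ - 1#
  i²≈-1 with trinomial-root 2 ℕ.≤-refl 0# (- 1#)
  ... | x , root = x , trans root (trans (+-congʳ (zeroˡ x)) (+-identityˡ _))

  i^p≈-i : p % 4 ≡ 3 → ∀ {i} → i ^ 2 ≈ - 1# → i ^ p ≈ - i
  i^p≈-i p%4≡3 {i} i²≈-1 = begin
    i ^ p                          ≡⟨ ≡.cong (i ^_) (ℕ.m≡m%n+[m/n]*n p 4) ⟩
    i ^ (p % 4 ℕ.+ q ℕ.* 4)        ≡⟨ ≡.cong₂ (λ r s → i ^ (r ℕ.+ s)) p%4≡3 (ℕ.*-comm q 4) ⟩
    i ^ (3 ℕ.+ 4 ℕ.* q)            ≈⟨ ^-homo-* i 3 (4 ℕ.* q) ⟩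
    i ^ 3 * i ^ (4 ℕ.* q)          ≈⟨ *-congˡ (^-assocʳ i 4 q) ⟨
    -- `i ^ 3` unfolds to `i * i ^ 2`.
    i ^ 3 * (i ^ 4) ^ q            ≈⟨ *-cong (*-congˡ i²≈-1) (trans (^-congˡ q i⁴≈1) (1^n≈1 q)) ⟩
    i * - 1# * 1#                  ≈⟨ *-identityʳ _ ⟩
    i * - 1#                       ≈⟨ -‿distribʳ-* i 1# ⟨
    - (i * 1#)                     ≈⟨ -‿cong (*-identityʳ i) ⟩
    - i                            ∎
    where
    q = p ℕ./ 4
    i⁴≈1 : i ^ 4 ≈ 1#
    i⁴≈1 = begin
      i ^ 4          ≈⟨ ^-assocʳ i 2 2 ⟨
      (i ^ 2) ^ 2    ≈⟨ ^-congˡ 2 i²≈-1 ⟩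
      (- 1#) ^ 2     ≈⟨ -x^2≈x^2 1# ⟩
      1# ^ 2         ≈⟨ 1^n≈1 2 ⟩
      1#             ∎

  -- evalMonic (c₀ ∷ … ∷ c_{d-1} ∷ []) x = c₀ + … + c_{d-1} x^{d-1} + x^d.
  evalMonic : ∀ {d} → Vec Carrier d → Carrier → Carrier
  evalMonic []       x = 1#
  evalMonic (c ∷ cs) x = c + x * evalMonic cs x

  -- Synthetic division by `x - r`: the coefficients of the quotient are the intermediate values of
  -- Horner's scheme at `r`.
  quotient : ∀ {d} → Vec Carrier (suc d) → Carrier → Vec Carrier d
  quotient (c ∷ [])       r = []
  quotient (c ∷ c′ ∷ cs)  r = evalMonic (c′ ∷ cs) r ∷ quotient (c′ ∷ cs) r

  -- f(x) − f(r) = (x − r) q(x), with the subtractions moved across.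
  quotient-eval : ∀ {d} (cs : Vec Carrier (suc d)) r x →
    evalMonic cs x + r * evalMonic (quotient cs r) x ≈
    evalMonic cs r + x * evalMonic (quotient cs r) x
  quotient-eval (c ∷ []) r x =
    solve 3 (λ c r x → (c :+ x :* con 1) :+ r :* con 1 := (c :+ r :* con 1) :+ x :* con 1) refl c r x
  quotient-eval (c ∷ c′ ∷ cs) r x = begin
    (c + x * h x) + r * (h r + x * q)
      ≈⟨ solve 6 (λ c x r hx hr q → (c :+ x :* hx) :+ r :* (hr :+ x :* q) :=
                                    (c :+ r :* hr) :+ x :* (hx :+ r :* q)) refl c x r (h x) (h r) q ⟩
    (c + r * h r) + x * (h x + r * q)
      ≈⟨ +-congˡ (*-congˡ (quotient-eval (c′ ∷ cs) r x)) ⟩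
    (c + r * h r) + x * (h r + x * q) ∎
    where
    h = evalMonic (c′ ∷ cs)
    q = evalMonic (quotient (c′ ∷ cs) r) x

  -- Splitting off `r zero` leaves the other roots to the quotient, because differences of distinct
  -- roots can be cancelled. The quotient is again monic, so at degree 0 a root would say `1# ≈ 0#`.
  too-many-roots : ∀ {d} (cs : Vec Carrier d) (r : Fin (suc d) → Carrier) →
    (∀ i j → r i ≈ r j → i ≡ j) → ¬ (∀ i → evalMonic cs (r i) ≈ 0#)
  too-many-roots []           r inj root = 0≉1 (sym (root zero))
  too-many-roots cs@(_ ∷ _) r inj root =
    too-many-roots (quotient cs (r zero)) (r ∘ suc)
      (λ i j e → suc-injective (inj (suc i) (suc j) e))
      (λ i → x*y≈0⇒y≈0 (distinct i) (factor i))
    where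
    distinct : ∀ i → ¬ r (suc i) - r zero ≈ 0#
    distinct i e with inj _ _ (x∙y⁻¹≈ε⇒x≈y _ _ e)
    ... | ()
    factor : ∀ i → (r (suc i) - r zero) * evalMonic (quotient cs (r zero)) (r (suc i)) ≈ 0#
    factor i = trans ([y-z]x≈yx-zx _ _ _) (x≈y⇒x∙y⁻¹≈ε (+-cancelˡ 0# _ _ (begin
      0# + r (suc i) * q                             ≈⟨ +-congʳ (root zero) ⟨
      evalMonic cs (r zero) + r (suc i) * q          ≈⟨ quotient-eval cs (r zero) (r (suc i)) ⟨
      evalMonic cs (r (suc i)) + r zero * q          ≈⟨ +-congʳ (root (suc i)) ⟩
      0# + r zero * q                                ∎)))
      where q = evalMonic (quotient cs (r zero)) (r (suc i))

  x^n-x : ∀ n → 2 ≤ n → ∃ λ (cs : Vec Carrier n) → ∀ x → x ^ n ≈ x → evalMonic cs x ≈ 0#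
  x^n-x (suc (suc m)) (s≤s (s≤s z≤n)) = 0# ∷ - 1# ∷ Vec.replicate m 0# , λ x e → begin
    0# + x * (- 1# + x * evalMonic (Vec.replicate m 0#) x) ≈⟨ +-identityˡ _ ⟩
    x * (- 1# + x * evalMonic (Vec.replicate m 0#) x)      ≈⟨ *-congˡ (+-congˡ (*-congˡ (power m x))) ⟩
    x * (- 1# + x * x ^ m)                                 ≈⟨ distribˡ x _ _ ⟩
    x * - 1# + x ^ suc (suc m)                             ≈⟨ +-cong (sym (-‿distribʳ-* x 1#)) e ⟩
    - (x * 1#) + x                                         ≈⟨ +-congʳ (-‿cong (*-identityʳ x)) ⟩
    - x + x                                                ≈⟨ -‿inverseˡ x ⟩
    0#                                                     ∎
    where
    power : ∀ m x → evalMonic (Vec.replicate m 0#) x ≈ x ^ m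
    power zero    x = refl
    power (suc m) x = trans (+-identityˡ _) (*-congˡ (power m x))

  x*m·1≈0 : ∀ x m → m · 1# ≈ 0# → (x ℕ.* m) · 1# ≈ 0#
  x*m·1≈0 x m e = trans (×1-homo-* x m) (trans (*-congˡ e) (zeroʳ _))

  -- `k` and `p` are coprime, so 1 is the difference of a multiple of one and a multiple of the
  -- other; if both annihilated `1#`, then `1#` would be zero.
  k·1≉0 : ∀ k → 0 < k → k < p → ¬ k · 1# ≈ 0#
  k·1≉0 k 0<k k<p k·1≈0 with coprime-Bézout (prime⇒coprime p-prime {{ℕ.>-nonZero 0<k}} k<p)
  ... | Bézout.+- x y eq = 0≉1 (trans (sym (x*m·1≈0 x p characteristic))
                                 (trans (×-congˡ (≡.sym eq)) (trans (+-congˡ (x*m·1≈0 y k k·1≈0)) (+-identityʳ _))))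
  ... | Bézout.-+ x y eq = 0≉1 (trans (sym (x*m·1≈0 y k k·1≈0))
                                 (trans (×-congˡ (≡.sym eq)) (trans (+-congˡ (x*m·1≈0 x p characteristic)) (+-identityʳ _))))

  ·1-injective : ∀ m n → m < p → n < p → m · 1# ≈ n · 1# → m ≡ n
  ·1-injective zero    zero    _   _   e = ≡.refl
  ·1-injective zero    (suc n) _   n<p e = contradiction (sym e) (k·1≉0 (suc n) ℕ.z<s n<p)
  ·1-injective (suc m) zero    m<p _   e = contradiction e (k·1≉0 (suc m) ℕ.z<s m<p)
  ·1-injective (suc m) (suc n) m<p n<p e = ≡.cong suc
    (·1-injective m n (ℕ.<⇒≤ m<p) (ℕ.<⇒≤ n<p) (+-cancelˡ 1# _ _ e))

  -- Otherwise `x` and the `p` multiples of `1#` would be `p + 1` distinct roots of the monic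
  -- polynomial `x^p - x` of degree `p`.
  ^p-fixed⇒𝔽ₚ : ∀ {x} → x ^ p ≈ x → 𝔽ₚ x
  ^p-fixed⇒𝔽ₚ {x} x^p≈x with any? {n = p} (λ k → x ≟ toℕ k · 1#)
  ... | yes (k , e) = toℕ k , e
  ... | no  x∉𝔽ₚ    = contradiction (λ i → proj₂ (x^n-x p p≥2) (r i) (fixed i))
                        (too-many-roots (proj₁ (x^n-x p p≥2)) r distinct)
    where
    r : Fin (suc p) → Carrier
    r zero    = x
    r (suc k) = toℕ k · 1#
    fixed : ∀ i → r i ^ p ≈ r i
    fixed zero    = x^p≈x
    fixed (suc k) = 𝔽ₚ-^p (toℕ k , refl)
    distinct : ∀ i j → r i ≈ r j → i ≡ j
    distinct zero    zero    e = ≡.refl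
    distinct zero    (suc k) e = contradiction (k , e) x∉𝔽ₚ
    distinct (suc k) zero    e = contradiction (k , sym e) x∉𝔽ₚ
    distinct (suc k) (suc l) e = ≡.cong suc (toℕ-injective (·1-injective _ _ (toℕ<n k) (toℕ<n l) e))

  -- Galois descent

  -- Given by membership alone: the forms representing a morphism come without a basis, and descent
  -- treats one member at a time.
  record StableSubspace (N : ℕ) (g : Level) : Set (c ⊔ ℓ ⊔ lsuc g) where
    field
      Member : (Fin N → Carrier) → Set g
      resp     : ∀ {F G} → (∀ i → F i ≈ G i) → Member F → Member G
      0-closed : Member (λ _ → 0#)
      +-closed : ∀ {F G} → Member F → Member G → Member (λ i → F i + G i)
      *-closed : ∀ k {F} → Member F → Member (λ i → k * F i)
      ^p-closed : ∀ {F} → Member F → Member (λ i → F i ^ p)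

  open StableSubspace

  infixr 5 0∷_
  0∷_ : ∀ {N} → (Fin N → Carrier) → Fin (suc N) → Carrier
  (0∷ F) zero    = 0#
  (0∷ F) (suc i) = F i

  -- The intersection with the hyperplane of first coordinate zero, on which descent recurses.
  drop₁ : ∀ {N g} → StableSubspace (suc N) g → StableSubspace N g
  drop₁ V = record
    { Member    = λ F → Member V (0∷ F)
    ; resp      = λ e → resp V λ { zero → refl ; (suc i) → e i }
    ; 0-closed  = resp V (λ { zero → refl ; (suc i) → refl }) (0-closed V)
    ; +-closed  = λ F G → resp V (λ { zero → +-identityˡ 0# ; (suc i) → refl }) (+-closed V F G)
    ; *-closed  = λ k F → resp V (λ { zero → zeroʳ k ; (suc i) → refl }) (*-closed V k F)
    ; ^p-closed = λ F → resp V (λ { zero → 0^p≈0 ; (suc i) → refl }) (^p-closed V F)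
    }

  -- The linear combination is kept as explicit data so that `span-artinSchreier` can replace its
  -- coefficients one at a time.
  data RationalSpan {N g} (V : StableSubspace N g) (F : Fin N → Carrier) : Set (c ⊔ ℓ ⊔ g) where
    none : (∀ i → F i ≈ 0#) → RationalSpan V F
    more : ∀ d {y G} → Member V y → (∀ i → 𝔽ₚ (y i)) → RationalSpan V G →
           (∀ i → F i ≈ d * y i + G i) → RationalSpan V F

  module _ {N g} (V : StableSubspace N g) where

    span⇒∈ : ∀ {F} → RationalSpan V F → Member V F
    span⇒∈ (none F≈0)        = resp V (sym ∘ F≈0) (0-closed V)
    span⇒∈ (more d y∈ _ G e) = resp V (sym ∘ e) (+-closed V (*-closed V d y∈) (span⇒∈ G))

    span-* : ∀ k {F F′} → (∀ i → F′ i ≈ k * F i) → RationalSpan V F → RationalSpan V F′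
    span-* k F′≈kF (none F≈0) = none λ i → trans (F′≈kF i) (trans (*-congˡ (F≈0 i)) (zeroʳ k))
    span-* k F′≈kF (more d y∈ y∈𝔽ₚ G e) = more (k * d) y∈ y∈𝔽ₚ (span-* k (λ _ → refl) G) λ i →
      trans (F′≈kF i) (trans (*-congˡ (e i))
        (solve 4 (λ k d y g → k :* (d :* y :+ g) := k :* d :* y :+ k :* g) refl k d _ _))

    -- The vectors `y` are fixed by the p-th power, so raising a combination of them to the p-th
    -- power acts on the coefficients only. The vector equation thus decouples into one
    -- Artin-Schreier equation per coefficient.
    span-artinSchreier : ∀ {H} → RationalSpan V H →
      ∃ λ Y → RationalSpan V Y × (∀ i → Y i ^ p ≈ Y i + H i)
    span-artinSchreier (none H≈0) = (λ _ → 0#) , none (λ _ → refl) , λ i →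
      trans 0^p≈0 (sym (trans (+-identityˡ _) (H≈0 i)))
    span-artinSchreier {H} (more d {y} {G} y∈ y∈𝔽ₚ G-span e)
      with span-artinSchreier G-span | artinSchreier-root d
    ... | Z , Z-span , Z-root | r , r-root =
      (λ i → r * y i + Z i) , more r y∈ y∈𝔽ₚ Z-span (λ _ → refl) , λ i → begin
        (r * y i + Z i) ^ p              ≈⟨ ^p-homo-+ _ _ ⟩
        (r * y i) ^ p + Z i ^ p          ≈⟨ +-cong (^-distrib-* r (y i) p) (Z-root i) ⟩
        r ^ p * y i ^ p + (Z i + G i)    ≈⟨ +-congʳ (*-cong r-root (𝔽ₚ-^p (y∈𝔽ₚ i))) ⟩
        (r + d) * y i + (Z i + G i)
          ≈⟨ solve 5 (λ r d y z g → (r :+ d) :* y :+ (z :+ g) := (r :* y :+ z) :+ (d :* y :+ g))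
               refl r d (y i) (Z i) (G i) ⟩
        (r * y i + Z i) + (d * y i + G i) ≈⟨ +-congˡ (e i) ⟨
        (r * y i + Z i) + H i             ∎

  span-0∷ : ∀ {N g} (V : StableSubspace (suc N) g) {F F′} → F′ zero ≈ 0# → (∀ i → F′ (suc i) ≈ F i) →
            RationalSpan (drop₁ V) F → RationalSpan V F′
  span-0∷ V z s (none F≈0) = none λ { zero → z ; (suc i) → trans (s i) (F≈0 i) }
  span-0∷ V z s (more d {y} {G} y∈ y∈𝔽ₚ G-span e) =
    more d {0∷ y} {0∷ G} y∈ (λ { zero → 0 , refl ; (suc i) → y∈𝔽ₚ i }) (span-0∷ V refl (λ _ → refl) G-span)
      λ { zero → trans z (sym (trans (+-identityʳ _) (zeroʳ d))) ; (suc i) → trans (s i) (e i) }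

  -- M is F scaled to have first coordinate 1, so H = M^p − M has one coordinate less and
  -- is in the span by induction; solving e^p − e = d for each of its coefficients d gives
  -- Y in the span with Y^p − Y = H, and M − Y is fixed by Frobenius.
  descent : ∀ {N g} (V : StableSubspace N g) {F} → Member V F → RationalSpan V F
  descent {zero}  V {F} F∈ = none λ ()
  descent {suc N} V {F} F∈ with F zero ≟ 0#
  ... | yes F₀≈0 = span-0∷ V F₀≈0 (λ _ → refl)
                     (descent (drop₁ V) (resp V (λ { zero → F₀≈0 ; (suc i) → refl }) F∈))
  ... | no  F₀≉0 = rescale (span-artinSchreier V H-span)
    where
    M H : Fin (suc N) → Carrier
    M i = F zero ⁻¹ * F i
    H i = M i ^ p - M i
    M₀≈1 : M zero ≈ 1#
    M₀≈1 = trans (*-comm _ _) (*-inverseʳ _ F₀≉0)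
    M∈ : Member V M
    M∈ = *-closed V _ F∈
    H₀≈0 : H zero ≈ 0#
    H₀≈0 = x≈y⇒x∙y⁻¹≈ε (trans (^-congˡ p M₀≈1) (trans (1^n≈1 p) (sym M₀≈1)))
    neg∈ : ∀ {G} → Member V G → Member V (λ i → - G i)
    neg∈ G∈ = resp V (λ i → -1*x≈-x _) (*-closed V (- 1#) G∈)
    H∈ : Member V H
    H∈ = +-closed V (^p-closed V M∈) (neg∈ M∈)
    H-span : RationalSpan V H
    H-span = span-0∷ V H₀≈0 (λ _ → refl)
               (descent (drop₁ V) (resp V (λ { zero → H₀≈0 ; (suc i) → refl }) H∈))
    rescale : (∃ λ Y → RationalSpan V Y × (∀ i → Y i ^ p ≈ Y i + H i)) → RationalSpan V F
    -- `M` is the rational member `M - Y` plus `Y`, which is already in the span; multiplying by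
    -- `F zero` undoes the scaling.
    rescale (Y , Y-span , Y-root) = span-* V (F zero) F≈F₀M
      (more 1# (+-closed V M∈ (neg∈ (span⇒∈ V Y-span))) (λ i → ^p-fixed⇒𝔽ₚ (fixed i)) Y-span
        (λ i → sym (trans (+-congʳ (*-identityˡ _)) (cancel (M i) (Y i)))))
      where
      cancel : ∀ x y → (x - y) + y ≈ x
      cancel x y = trans (+-assoc _ _ _) (trans (+-congˡ (-‿inverseˡ y)) (+-identityʳ x))
      F≈F₀M : ∀ i → F i ≈ F zero * M i
      F≈F₀M i = sym (trans (sym (*-assoc _ _ _)) (trans (*-congʳ (*-inverseʳ _ F₀≉0)) (*-identityˡ _)))
      fixed : ∀ i → (M i - Y i) ^ p ≈ M i - Y i
      -- The added `Y i + H i` equals `Y i ^ p`, which completes the left side to `M i ^ p`, that is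
      -- `M i + H i`.
      fixed i = +-cancelʳ (Y i + H i) _ _ (begin
        (M i - Y i) ^ p + (Y i + H i)   ≈⟨ +-congˡ (Y-root i) ⟨
        (M i - Y i) ^ p + Y i ^ p       ≈⟨ ^p-homo-+ _ _ ⟨
        ((M i - Y i) + Y i) ^ p         ≈⟨ ^-congˡ p (cancel (M i) (Y i)) ⟩
        M i ^ p                         ≈⟨ cancel (M i ^ p) (M i) ⟨
        H i + M i                       ≈⟨ +-comm _ _ ⟩
        M i + H i                       ≈⟨ +-congʳ (cancel (M i) (Y i)) ⟨
        ((M i - Y i) + Y i) + H i       ≈⟨ +-assoc _ _ _ ⟩
        (M i - Y i) + (Y i + H i)       ∎)

  -- Polynomials

  monomial-cong : ∀ {n} (es : Vec ℕ n) {xs ys : Vec Carrier n} →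
    (∀ i → lookup xs i ≈ lookup ys i) → monomial es xs ≈ monomial es ys
  monomial-cong []       {[]}     {[]}     e = refl
  monomial-cong (k ∷ es) {x ∷ xs} {y ∷ ys} e = *-cong (^-congˡ k (e zero)) (monomial-cong es (e ∘ suc))

  eval-cong : ∀ {n} (f : Poly n) {xs ys : Vec Carrier n} →
    (∀ i → lookup xs i ≈ lookup ys i) → eval f xs ≈ eval f ys
  eval-cong []             e = refl
  eval-cong ((k , es) ∷ f) e = +-cong (*-congˡ (monomial-cong es e)) (eval-cong f e)

  monomial-scale : ∀ {n} (es : Vec ℕ n) {xs ys : Vec Carrier n} u →
    (∀ i → lookup xs i ≈ u * lookup ys i) → monomial es xs ≈ u ^ Vec.sum es * monomial es ys
  monomial-scale []       {[]}     {[]}     u e = sym (*-identityˡ 1#)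
  monomial-scale (k ∷ es) {x ∷ xs} {y ∷ ys} u e = begin
    x ^ k * monomial es xs
      ≈⟨ *-cong (trans (^-congˡ k (e zero)) (^-distrib-* u y k)) (monomial-scale es u (e ∘ suc)) ⟩
    (u ^ k * y ^ k) * (u ^ Vec.sum es * monomial es ys)
      ≈⟨ solve 4 (λ a b c d → (a :* b) :* (c :* d) := (a :* c) :* (b :* d)) refl _ _ _ _ ⟩
    (u ^ k * u ^ Vec.sum es) * (y ^ k * monomial es ys)
      ≈⟨ *-congʳ (^-homo-* u k (Vec.sum es)) ⟨
    u ^ (k ℕ.+ Vec.sum es) * (y ^ k * monomial es ys) ∎

  eval-scale : ∀ {n d} {f : Poly n} → Homogeneous d f → ∀ {xs ys : Vec Carrier n} u →
    (∀ i → lookup xs i ≈ u * lookup ys i) → eval f xs ≈ u ^ d * eval f ys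
  eval-scale []                            u e = sym (zeroʳ _)
  eval-scale {f = (k , es) ∷ f} (≡.refl ∷ h) {xs} {ys} u e = begin
    k * monomial es xs + eval f xs
      ≈⟨ +-cong (*-congˡ (monomial-scale es u e)) (eval-scale h u e) ⟩
    k * (u ^ d * monomial es ys) + u ^ d * eval f ys
      ≈⟨ solve 4 (λ k u m g → k :* (u :* m) :+ u :* g := u :* (k :* m :+ g)) refl k _ _ _ ⟩
    u ^ d * (k * monomial es ys + eval f ys) ∎
    where d = Vec.sum es

  monomial-^p : ∀ {n} (es : Vec ℕ n) {xs ys : Vec Carrier n} →
    (∀ i → lookup ys i ≈ lookup xs i ^ p) → monomial es ys ≈ monomial es xs ^ p
  monomial-^p []       {[]}     {[]}     e = sym (1^n≈1 p)
  monomial-^p (k ∷ es) {x ∷ xs} {y ∷ ys} e = begin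
    y ^ k * monomial es ys            ≈⟨ *-cong (^-congˡ k (e zero)) (monomial-^p es (e ∘ suc)) ⟩
    (x ^ p) ^ k * monomial es xs ^ p  ≈⟨ *-congʳ (^-assocʳ x p k) ⟩
    x ^ (p ℕ.* k) * monomial es xs ^ p  ≡⟨ ≡.cong (λ m → x ^ m * monomial es xs ^ p) (ℕ.*-comm p k) ⟩
    x ^ (k ℕ.* p) * monomial es xs ^ p  ≈⟨ *-congʳ (^-assocʳ x k p) ⟨
    (x ^ k) ^ p * monomial es xs ^ p  ≈⟨ ^-distrib-* _ _ p ⟨
    (x ^ k * monomial es xs) ^ p      ∎

  eval-^p : ∀ {n} {f : Poly n} → CoefficientsIn 𝔽ₚ f → ∀ {xs ys : Vec Carrier n} →
    (∀ i → lookup ys i ≈ lookup xs i ^ p) → eval f ys ≈ eval f xs ^ p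
  eval-^p []                               e = sym 0^p≈0
  eval-^p {f = (k , es) ∷ f} (k∈𝔽ₚ ∷ f∈𝔽ₚ) {xs} {ys} e = begin
    k * monomial es ys + eval f ys           ≈⟨ +-cong (*-cong (sym (𝔽ₚ-^p k∈𝔽ₚ)) (monomial-^p es e)) (eval-^p f∈𝔽ₚ e) ⟩
    k ^ p * monomial es xs ^ p + eval f xs ^ p ≈⟨ +-congʳ (^-distrib-* _ _ p) ⟨
    (k * monomial es xs) ^ p + eval f xs ^ p   ≈⟨ ^p-homo-+ _ _ ⟨
    (k * monomial es xs + eval f xs) ^ p     ∎

  eval-++ : ∀ {n} (f g : Poly n) xs → eval (f ++ g) xs ≈ eval f xs + eval g xs
  eval-++ []             g xs = sym (+-identityˡ _)
  eval-++ ((k , es) ∷ f) g xs = trans (+-congˡ (eval-++ f g xs)) (sym (+-assoc _ _ _))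

  monomial-+ : ∀ {n} (es es′ : Vec ℕ n) xs →
    monomial (Vec.zipWith ℕ._+_ es es′) xs ≈ monomial es xs * monomial es′ xs
  monomial-+ []       []         []       = sym (*-identityˡ 1#)
  monomial-+ (k ∷ es) (k′ ∷ es′) (x ∷ xs) = trans
    (*-cong (^-homo-* x k k′) (monomial-+ es es′ xs))
    (solve 4 (λ a b c d → (a :* b) :* (c :* d) := (a :* c) :* (b :* d)) refl _ _ _ _)

  sum-zipWith-+ : ∀ {n} (es es′ : Vec ℕ n) →
    Vec.sum (Vec.zipWith ℕ._+_ es es′) ≡ Vec.sum es ℕ.+ Vec.sum es′
  sum-zipWith-+ []       []         = ≡.refl
  sum-zipWith-+ (k ∷ es) (k′ ∷ es′) = ≡.trans (≡.cong (k ℕ.+ k′ ℕ.+_) (sum-zipWith-+ es es′))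
    (interchange k k′ (Vec.sum es) (Vec.sum es′))
    where open import Algebra.Properties.CommutativeSemigroup ℕ.+-commutativeSemigroup using (interchange)

  infixl 7 _⊗ₜ_ _⊗_

  _⊗ₜ_ : ∀ {n} → Carrier × Vec ℕ n → Poly n → Poly n
  (k , es) ⊗ₜ g = List.map (λ (k′ , es′) → k * k′ , Vec.zipWith ℕ._+_ es es′) g

  _⊗_ : ∀ {n} → Poly n → Poly n → Poly n
  []      ⊗ g = []
  (t ∷ f) ⊗ g = t ⊗ₜ g ++ f ⊗ g

  eval-⊗ₜ : ∀ {n} k es (g : Poly n) xs → eval ((k , es) ⊗ₜ g) xs ≈ k * monomial es xs * eval g xs
  eval-⊗ₜ k es []               xs = sym (zeroʳ _)
  eval-⊗ₜ k es ((k′ , es′) ∷ g) xs = trans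
    (+-cong (*-congˡ (monomial-+ es es′ xs)) (eval-⊗ₜ k es g xs))
    (solve 5 (λ k k′ m m′ g → k :* k′ :* (m :* m′) :+ k :* m :* g := k :* m :* (k′ :* m′ :+ g)) refl _ _ _ _ _)

  eval-⊗ : ∀ {n} (f g : Poly n) xs → eval (f ⊗ g) xs ≈ eval f xs * eval g xs
  eval-⊗ []             g xs = sym (zeroˡ _)
  eval-⊗ ((k , es) ∷ f) g xs = begin
    eval ((k , es) ⊗ₜ g ++ f ⊗ g) xs                          ≈⟨ eval-++ ((k , es) ⊗ₜ g) (f ⊗ g) xs ⟩
    eval ((k , es) ⊗ₜ g) xs + eval (f ⊗ g) xs                 ≈⟨ +-cong (eval-⊗ₜ k es g xs) (eval-⊗ f g xs) ⟩
    k * monomial es xs * eval g xs + eval f xs * eval g xs    ≈⟨ distribʳ _ _ _ ⟨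
    (k * monomial es xs + eval f xs) * eval g xs              ∎

  homogeneous-⊗ : ∀ {n d e} {f g : Poly n} → Homogeneous d f → Homogeneous e g → Homogeneous (d ℕ.+ e) (f ⊗ g)
  homogeneous-⊗ []                              hg = []
  homogeneous-⊗ {f = (k , es) ∷ f} (≡.refl ∷ hf) hg = All.++⁺
    (All.map⁺ (All.map (λ {t} e → ≡.trans (sum-zipWith-+ es (proj₂ t)) (≡.cong (Vec.sum es ℕ.+_) e)) hg))
    (homogeneous-⊗ hf hg)

  one : ∀ {n} → Poly n
  one = (1# , Vec.replicate _ 0) ∷ []

  eval-one : ∀ {n} (xs : Vec Carrier n) → eval one xs ≈ 1#
  eval-one xs = trans (+-identityʳ _) (trans (*-identityˡ _) (unit xs))
    where
    unit : ∀ {n} (xs : Vec Carrier n) → monomial (Vec.replicate n 0) xs ≈ 1#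
    unit []       = refl
    unit (x ∷ xs) = trans (*-identityˡ _) (unit xs)

  homogeneous-one : ∀ {n} → Homogeneous 0 (one {n})
  homogeneous-one {n} = zeros n ∷ []
    where
    zeros : ∀ n → Vec.sum (Vec.replicate n 0) ≡ 0
    zeros zero    = ≡.refl
    zeros (suc n) = zeros n

  pow : ∀ {n} → Poly n → ℕ → Poly n
  pow f zero    = one
  pow f (suc k) = f ⊗ pow f k

  eval-pow : ∀ {n} (f : Poly n) k xs → eval (pow f k) xs ≈ eval f xs ^ k
  eval-pow f zero    xs = eval-one xs
  eval-pow f (suc k) xs = trans (eval-⊗ f (pow f k) xs) (*-congˡ (eval-pow f k xs))

  homogeneous-pow : ∀ {n d} {f : Poly n} k → Homogeneous d f → Homogeneous (k ℕ.* d) (pow f k)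
  homogeneous-pow zero    h = homogeneous-one
  homogeneous-pow (suc k) h = homogeneous-⊗ h (homogeneous-pow k h)

  infixr 7 _⊙_
  _⊙_ : ∀ {n} → Carrier → Poly n → Poly n
  k ⊙ f = List.map (λ (k′ , es) → k * k′ , es) f

  eval-⊙ : ∀ {n} k (f : Poly n) xs → eval (k ⊙ f) xs ≈ k * eval f xs
  eval-⊙ k []              xs = sym (zeroʳ k)
  eval-⊙ k ((k′ , es) ∷ f) xs = trans (+-cong (*-assoc _ _ _) (eval-⊙ k f xs)) (sym (distribˡ _ _ _))

  substMonomial : ∀ {m n} → Vec ℕ m → Vec (Poly n) m → Poly n
  substMonomial []       []       = one
  substMonomial (e ∷ es) (f ∷ fs) = pow f e ⊗ substMonomial es fs

  -- Serves both the composition of morphisms (`_∘ᵢ_`) and the pullback of functions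
  -- (`pullbackPoly`).
  subst : ∀ {m n} → Poly m → Vec (Poly n) m → Poly n
  subst []             F = []
  subst ((k , es) ∷ g) F = k ⊙ substMonomial es F ++ subst g F

  evals : ∀ {m n} → Vec (Poly n) m → Vec Carrier n → Vec Carrier m
  evals F xs = Vec.map (λ f → eval f xs) F

  eval-substMonomial : ∀ {m n} es (F : Vec (Poly n) m) xs →
    eval (substMonomial es F) xs ≈ monomial es (evals F xs)
  eval-substMonomial []       []      xs = eval-one xs
  eval-substMonomial (e ∷ es) (f ∷ F) xs = trans (eval-⊗ (pow f e) _ xs)
    (*-cong (eval-pow f e xs) (eval-substMonomial es F xs))

  eval-subst : ∀ {m n} g (F : Vec (Poly n) m) xs → eval (subst g F) xs ≈ eval g (evals F xs)
  eval-subst []             F xs = refl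
  eval-subst ((k , es) ∷ g) F xs = trans (eval-++ (k ⊙ substMonomial es F) _ xs)
    (+-cong (trans (eval-⊙ k (substMonomial es F) xs) (*-congˡ (eval-substMonomial es F xs))) (eval-subst g F xs))

  homogeneous-substMonomial : ∀ {m n d} es {F : Vec (Poly n) m} →
    (∀ i → Homogeneous d (lookup F i)) → Homogeneous (Vec.sum es ℕ.* d) (substMonomial es F)
  homogeneous-substMonomial         []       {[]}    h = homogeneous-one
  homogeneous-substMonomial {d = d} (e ∷ es) {f ∷ F} h = ≡.subst (λ m → Homogeneous m (substMonomial (e ∷ es) (f ∷ F)))
    (≡.sym (ℕ.*-distribʳ-+ d e (Vec.sum es)))
    (homogeneous-⊗ (homogeneous-pow e (h zero)) (homogeneous-substMonomial es (h ∘ suc)))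

  homogeneous-subst : ∀ {m n d e} {g} {F : Vec (Poly n) m} → Homogeneous e g →
    (∀ i → Homogeneous d (lookup F i)) → Homogeneous (e ℕ.* d) (subst g F)
  homogeneous-subst []                               hF = []
  homogeneous-subst {g = (k , es) ∷ g} (≡.refl ∷ hg) hF =
    All.++⁺ (All.map⁺ (homogeneous-substMonomial es hF)) (homogeneous-subst hg hF)

  -- Points and morphisms

  ≈ₚ-refl : ∀ {P} → P ≈ₚ P
  ≈ₚ-refl {O}       = O≈O
  ≈ₚ-refl {aff x y} = aff refl refl

  ≈ₚ-sym : ∀ {P Q} → P ≈ₚ Q → Q ≈ₚ P
  ≈ₚ-sym O≈O         = O≈O
  ≈ₚ-sym (aff ex ey) = aff (sym ex) (sym ey)

  ≈ₚ-trans : ∀ {P Q R} → P ≈ₚ Q → Q ≈ₚ R → P ≈ₚ R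
  ≈ₚ-trans O≈O       O≈O         = O≈O
  ≈ₚ-trans (aff e f) (aff e′ f′) = aff (trans e e′) (trans f f′)

  coords-cong : ∀ {P Q} → P ≈ₚ Q → ∀ i → lookup (coords P) i ≈ lookup (coords Q) i
  coords-cong O≈O         i                = refl
  coords-cong (aff ex ey) zero             = ex
  coords-cong (aff ex ey) (suc zero)       = ey
  coords-cong (aff ex ey) (suc (suc zero)) = refl

  coords-≉0 : ∀ P → ¬ (∀ i → lookup (coords P) i ≈ 0#)
  coords-≉0 O         e = 0≉1 (sym (e (suc zero)))
  coords-≉0 (aff x y) e = 0≉1 (sym (e (suc (suc zero))))

  -- The third coordinate is 1 at affine points and 0 at `O`. Two affine points therefore have
  -- `u ≈ v`, while a mixed pair leads to `u ≈ 0#`; hence it suffices that one factor is nonzero.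
  coords-unique : ∀ {A B u v} → ¬ u ≈ 0# →
    (∀ i → u * lookup (coords A) i ≈ v * lookup (coords B) i) → A ≈ₚ B
  coords-unique {O}       {O}                 u≉0 e = O≈O
  coords-unique {O}       {aff x y} {u} {v}   u≉0 e = contradiction u≈0 u≉0
    where
    v≈0 : v ≈ 0#
    v≈0 = trans (sym (*-identityʳ v)) (trans (sym (e (suc (suc zero)))) (zeroʳ u))
    u≈0 : u ≈ 0#
    u≈0 = trans (sym (*-identityʳ u)) (trans (e (suc zero)) (trans (*-congʳ v≈0) (zeroˡ y)))
  coords-unique {aff x y} {O}       {u} {v}   u≉0 e =
    contradiction (trans (sym (*-identityʳ u)) (trans (e (suc (suc zero))) (zeroʳ v))) u≉0
  coords-unique {aff x y} {aff x′ y′} {u} {v} u≉0 e = aff (cancel (e zero)) (cancel (e (suc zero)))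
    where
    u≈v : u ≈ v
    u≈v = trans (sym (*-identityʳ u)) (trans (e (suc (suc zero))) (*-identityʳ v))
    cancel : ∀ {s t} → u * s ≈ v * t → s ≈ t
    cancel us≈vt = *-cancelˡ-≉0 u≉0 (trans us≈vt (*-congʳ (sym u≈v)))

  sends-unique : ∀ F {P Q A B} → P ≈ₚ Q → ¬ Vanishes F P →
    F sends P to A → F sends Q to B → A ≈ₚ B
  sends-unique F P≈Q F≉0 (u , FP) (v , FQ) = coords-unique
    (λ u≈0 → F≉0 λ i → trans (FP i) (trans (*-congʳ u≈0) (zeroˡ _)))
    (λ i → trans (sym (FP i)) (trans (eval-cong (lookup F i) (coords-cong P≈Q)) (FQ i)))

  vanishes-cong : ∀ F {P Q} → P ≈ₚ Q → Vanishes F P → Vanishes F Q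
  vanishes-cong F P≈Q v i = trans (sym (eval-cong (lookup F i) (coords-cong P≈Q))) (v i)

  -- `_sends_to_` admits the factor 0, which is right wherever `F` vanishes. Without the
  -- nonvanishing hypothesis the condition becomes linear in `F`, as `representations` requires.
  sends-everywhere : ∀ {E E′ : EllipticCurve} (φ : Point E → Point E′) F →
    (∀ Q → ¬ Vanishes F (pt Q) → F sends pt Q to pt (φ Q)) → ∀ Q → F sends pt Q to pt (φ Q)
  sends-everywhere φ F s Q with all? (λ i → eval (lookup F i) (coords (pt Q)) ≟ 0#)
  ... | yes v = 0# , λ i → trans (v i) (sym (zeroˡ _))
  ... | no ¬v = s Q ¬v

  -- A map of points is a bare function, not assumed to respect `_≈ₚ_`; forms that represent it near
  -- a point force it to.
  definedOver-cong : ∀ {s} {S : Pred Carrier s} {E E′ : EllipticCurve} {φ : Point E → Point E′} →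
    DefinedOver S φ → ∀ {P Q : Point E} → pt P ≈ₚ pt Q → pt (φ P) ≈ₚ pt (φ Q)
  definedOver-cong {φ = φ} φ-def {P} {Q} P≈Q with φ-def P
  ... | d , F , _ , _ , F≉0 , F-sends = sends-unique F P≈Q F≉0 (F-sends P F≉0)
    (F-sends Q (F≉0 ∘ vanishes-cong F (≈ₚ-sym P≈Q)))

  map-cong : ∀ {E E′} (φ : Isogeny E E′) {P Q : Point E} → pt P ≈ₚ pt Q → pt (map φ P) ≈ₚ pt (map φ Q)
  map-cong φ {P} {Q} = definedOver-cong {φ = map φ} (morphism φ) {P} {Q}

  infixr 9 _∘ᵢ_
  _∘ᵢ_ : ∀ {E E′ E″} → Isogeny E′ E″ → Isogeny E E′ → Isogeny E E″
  _∘ᵢ_ {E} {E′} {E″} ψ φ = record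
    { map      = map ψ ∘ map φ
    ; morphism = forms
    ; map-O    = ≈ₚ-trans (map-cong ψ {map φ (O , tt)} {O , tt} (map-O φ)) (map-O ψ)
    }
    where
    forms : DefinedOver U (map ψ ∘ map φ)
    forms P with morphism φ P | morphism ψ (map φ P)
    ... | d , F , hF , _ , F≉0 , F-sends | e , G , hG , _ , G≉0 , G-sends =
      e ℕ.* d , H , hH , (λ i → All.universal (λ _ → _) (lookup H i)) , H≉0 , H-sends
      where
      H = Vec.map (λ g → subst g F) G
      hH : ∀ i → Homogeneous (e ℕ.* d) (lookup H i)
      hH i = ≡.subst (Homogeneous (e ℕ.* d)) (≡.sym (lookup-map i (λ g → subst g F) G)) (homogeneous-subst (hG i) hF)
      eval-H : ∀ {Q R} → ((u , _) : F sends Q to R) →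
        ∀ i → eval (lookup H i) (coords Q) ≈ u ^ e * eval (lookup G i) (coords R)
      eval-H {Q} {R} (u , FQ) i = begin
        eval (lookup H i) (coords Q)                ≡⟨ ≡.cong (λ h → eval h (coords Q)) (lookup-map i (λ g → subst g F) G) ⟩
        eval (subst (lookup G i) F) (coords Q)      ≈⟨ eval-subst (lookup G i) F (coords Q) ⟩
        eval (lookup G i) (evals F (coords Q))      ≈⟨ eval-scale (hG i) u (λ j →
                                                         trans (reflexive (lookup-map j _ F)) (FQ j)) ⟩
        u ^ e * eval (lookup G i) (coords R)        ∎
      H≉0 : ¬ Vanishes H (pt P)
      H≉0 v with F-sends P F≉0
      ... | FP@(u , FP≈) = G≉0 λ i → x*y≈0⇒y≈0
        (^-≉0 e λ u≈0 → F≉0 λ j → trans (FP≈ j) (trans (*-congʳ u≈0) (zeroˡ _)))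
        (trans (sym (eval-H FP i)) (v i))
      H-sends : ∀ Q → ¬ Vanishes H (pt Q) → H sends pt Q to pt (map ψ (map φ Q))
      H-sends Q _ with sends-everywhere (map φ) F F-sends Q | sends-everywhere (map ψ) G G-sends (map φ Q)
      ... | FQ@(u , _) | v , GR = u ^ e * v , λ i →
        trans (eval-H FQ i) (trans (*-congˡ (GR i)) (sym (*-assoc _ _ _)))

  -- Diagonal maps and the isomorphism (x , y) ↦ (-x , i y)

  diagonal : (Fin 3 → Carrier) → Vec (Poly 3) 3
  diagonal k = ((k zero             , 1 ∷ 0 ∷ 0 ∷ []) ∷ [])
             ∷ ((k (suc zero)       , 0 ∷ 1 ∷ 0 ∷ []) ∷ [])
             ∷ ((k (suc (suc zero)) , 0 ∷ 0 ∷ 1 ∷ []) ∷ []) ∷ []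

  eval-diagonal : ∀ k xs i → eval (lookup (diagonal k) i) xs ≈ k i * lookup xs i
  eval-diagonal k (x ∷ y ∷ z ∷ []) zero =
    solve 2 (λ k x → k :* (x :* con 1 :* (con 1 :* (con 1 :* con 1))) :+ con 0 := k :* x) refl _ _
  eval-diagonal k (x ∷ y ∷ z ∷ []) (suc zero) =
    solve 2 (λ k x → k :* (con 1 :* (x :* con 1 :* (con 1 :* con 1))) :+ con 0 := k :* x) refl _ _
  eval-diagonal k (x ∷ y ∷ z ∷ []) (suc (suc zero)) =
    solve 2 (λ k x → k :* (con 1 :* (con 1 :* (x :* con 1 :* con 1))) :+ con 0 := k :* x) refl _ _

  -- Diagonal linear forms with nonzero entries have no common zero in the projective plane, so the
  -- same triple works at every point.
  diagonal-definedOver : ∀ {s} {S : Pred Carrier s} {E E′ : EllipticCurve} (φ : Point E → Point E′) k →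
    (∀ i → S (k i)) → (∀ i → ¬ k i ≈ 0#) →
    (∀ Q → ∃ λ u → ∀ i → k i * lookup (coords (pt Q)) i ≈ u * lookup (coords (pt (φ Q))) i) →
    DefinedOver S φ
  diagonal-definedOver {S = S} φ k k∈S k≉0 φ-k P =
      1 , diagonal k
    , (λ { zero → ≡.refl ∷ [] ; (suc zero) → ≡.refl ∷ [] ; (suc (suc zero)) → ≡.refl ∷ [] })
    , (λ { zero → k∈S _ ∷ [] ; (suc zero) → k∈S _ ∷ [] ; (suc (suc zero)) → k∈S _ ∷ [] })
    , (λ v → coords-≉0 (pt P) λ i → x*y≈0⇒y≈0 (k≉0 i) (trans (sym (eval-diagonal k (coords (pt P)) i)) (v i)))
    , λ Q _ → proj₁ (φ-k Q) , λ i → trans (eval-diagonal k (coords (pt Q)) i) (proj₂ (φ-k Q) i)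

  identity-definedOver : ∀ {s} {S : Pred Carrier s} {E : EllipticCurve} → S 1# → DefinedOver S (id {A = Point E})
  identity-definedOver 1∈S = diagonal-definedOver id (λ _ → 1#) (λ _ → 1∈S) (λ _ → 0≉1 ∘ sym) λ Q → 1# , λ i → refl

  idᵢ : ∀ {E} → Isogeny E E
  idᵢ = record { map = id ; morphism = identity-definedOver _ ; map-O = O≈O }

  -- The curves are related by equations between coefficients because `twist (twist E)` has the
  -- coefficient `- - b` and is not literally `E`. Both τ and its inverse are instances.
  module Flip (E E′ : EllipticCurve)
    (a′≈a : EllipticCurve.a E′ ≈ EllipticCurve.a E) (b′≈-b : EllipticCurve.b E′ ≈ - EllipticCurve.b E)
    {i} (i²≈-1 : i ^ 2 ≈ - 1#) where

    open EllipticCurve E using (a; b)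
    open EllipticCurve E′ using () renaming (a to a′; b to b′)

    flip-onCurve : ∀ {x y} → y ^ 2 ≈ x ^ 3 + a * x + b → (i * y) ^ 2 ≈ (- x) ^ 3 + a′ * - x + b′
    flip-onCurve {x} {y} e = begin
      (i * y) ^ 2                        ≈⟨ ^-distrib-* i y 2 ⟩
      i ^ 2 * y ^ 2                      ≈⟨ *-cong i²≈-1 e ⟩
      - 1# * (x ^ 3 + a * x + b)         ≈⟨ solve 4 (λ m x3 ax b → m :* (x3 :+ ax :+ b) := m :* x3 :+ m :* ax :+ m :* b) refl (- 1#) _ _ _ ⟩
      - 1# * x ^ 3 + - 1# * (a * x) + - 1# * b
        ≈⟨ +-cong (+-cong (-1*x≈-x _) (-1*x≈-x _)) (-1*x≈-x b) ⟩
      - (x * x ^ 2) - a * x - b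
        ≈⟨ +-cong (+-cong (-‿distribˡ-* x _) (-‿distribʳ-* a x)) (sym b′≈-b) ⟩
      - x * x ^ 2 + a * - x + b′         ≈⟨ +-congʳ (+-cong (*-congˡ (-x^2≈x^2 x)) (*-congʳ a′≈a)) ⟨
      (- x) ^ 3 + a′ * - x + b′          ∎

    flip-map : Point E → Point E′
    flip-map (O       , _) = O , tt
    flip-map (aff x y , e) = aff (- x) (i * y) , flip-onCurve e

    i≉0 : ¬ i ≈ 0#
    i≉0 i≈0 = 0≉1 (sym (trans (sym (-‿involutive 1#)) (trans (-‿cong (trans (sym i²≈-1) (trans (*-congʳ i≈0) (zeroˡ _)))) -0#≈0#)))

    flip : Isogeny E E′
    flip = record
      { map      = flip-map
      ; morphism = diagonal-definedOver flip-map k _ k≉0 λ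
          -- The triple (-x : i y : z) takes (0 : 1 : 0) to (0 : i : 0), hence the factor `i` at `O`
          -- and `1#` elsewhere.
          { (O       , _) → i , λ { zero → trans (zeroʳ _) (sym (zeroʳ _)) ; (suc zero) → refl ; (suc (suc zero)) → trans (zeroʳ _) (sym (zeroʳ _)) }
          ; (aff x y , _) → 1# , λ { zero → trans (-1*x≈-x x) (sym (*-identityˡ _)) ; (suc zero) → sym (*-identityˡ _) ; (suc (suc zero)) → refl }
          }
      ; map-O    = O≈O
      }
      where
      k : Fin 3 → Carrier
      k zero             = - 1#
      k (suc zero)       = i
      k (suc (suc zero)) = 1#
      k≉0 : ∀ j → ¬ k j ≈ 0#
      k≉0 zero             e = 0≉1 (sym (trans (sym (-‿involutive 1#)) (trans (-‿cong e) -0#≈0#)))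
      k≉0 (suc zero)         = i≉0
      k≉0 (suc (suc zero)) e = 0≉1 (sym e)

  -- Frobenius and fields of definition

  coords-frobenius : ∀ {E} (P : Point E) i → lookup (coords (pt (frobenius P))) i ≈ lookup (coords (pt P)) i ^ p
  coords-frobenius (O       , _) zero             = sym 0^p≈0
  coords-frobenius (O       , _) (suc zero)       = sym (1^n≈1 p)
  coords-frobenius (O       , _) (suc (suc zero)) = sym 0^p≈0
  coords-frobenius (aff x y , _) zero             = refl
  coords-frobenius (aff x y , _) (suc zero)       = refl
  coords-frobenius (aff x y , _) (suc (suc zero)) = sym (1^n≈1 p)

  -- The p-th roots of the coordinates satisfy the curve equation because its p-th power holds and
  -- the p-th power is injective.
  frobenius-surjective : ∀ {E} (Q : Point E) → ∃ λ (P : Point E) → pt (frobenius P) ≈ₚ pt Q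
  frobenius-surjective     (O       , _) = (O , tt) , O≈O
  frobenius-surjective {E} (aff x y , e) with pth-root x | pth-root y
  ... | r , r^p≈x | s , s^p≈y = (aff r s , ^p-injective (begin
    (s ^ 2) ^ p                            ≈⟨ swap s 2 ⟩
    (s ^ p) ^ 2                            ≈⟨ ^-congˡ 2 s^p≈y ⟩
    y ^ 2                                  ≈⟨ e ⟩
    x ^ 3 + a * x + b
      ≈⟨ +-cong (+-cong (^-congˡ 3 (sym r^p≈x)) (*-cong (sym (𝔽ₚ-^p a∈𝔽ₚ)) (sym r^p≈x))) (sym (𝔽ₚ-^p b∈𝔽ₚ)) ⟩
    (r ^ p) ^ 3 + a ^ p * r ^ p + b ^ p    ≈⟨ +-congʳ (+-cong (swap r 3) (^-distrib-* a r p)) ⟨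
    (r ^ 3) ^ p + (a * r) ^ p + b ^ p      ≈⟨ +-congʳ (^p-homo-+ _ _) ⟨
    (r ^ 3 + a * r) ^ p + b ^ p            ≈⟨ ^p-homo-+ _ _ ⟨
    (r ^ 3 + a * r + b) ^ p                ∎)) , aff r^p≈x s^p≈y
    where
    open EllipticCurve E
    swap : ∀ z n → (z ^ n) ^ p ≈ (z ^ p) ^ n
    swap z n = begin
      (z ^ n) ^ p      ≈⟨ ^-assocʳ z n p ⟩
      z ^ (n ℕ.* p)    ≡⟨ ≡.cong (z ^_) (ℕ.*-comm n p) ⟩
      z ^ (p ℕ.* n)    ≈⟨ ^-assocʳ z p n ⟨
      (z ^ p) ^ n      ∎

  -- For rational `F`, the value at the Frobenius image of `P` is the p-th power of the value at
  -- `P`. So `F` does not vanish there either, and one triple computes φ at both points.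
  definedOver-𝔽ₚ⇒commutes : ∀ {E E′ : EllipticCurve} {φ : Point E → Point E′} → DefinedOver 𝔽ₚ φ →
    ∀ P → pt (φ (frobenius P)) ≈ₚ pt (frobenius (φ P))
  definedOver-𝔽ₚ⇒commutes {φ = φ} φ-def P with φ-def P
  ... | d , F , _ , F∈𝔽ₚ , F≉0 , F-sends with F-sends P F≉0
  ... | u , FP = ≈ₚ-sym (coords-unique (λ uᵖ≈0 → F≉0 λ i →
                   trans (FP i) (trans (*-congʳ (^≈0⇒≈0 p uᵖ≈0)) (zeroˡ _)))
                 (λ i → trans (sym (eval-Frob i)) (proj₂ FFrobP i)))
    where
    eval-Frob : ∀ i → eval (lookup F i) (coords (pt (frobenius P))) ≈ u ^ p * lookup (coords (pt (frobenius (φ P)))) i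
    eval-Frob i = begin
      eval (lookup F i) (coords (pt (frobenius P)))  ≈⟨ eval-^p (F∈𝔽ₚ i) (coords-frobenius P) ⟩
      eval (lookup F i) (coords (pt P)) ^ p          ≈⟨ ^-congˡ p (FP i) ⟩
      (u * lookup (coords (pt (φ P))) i) ^ p         ≈⟨ ^-distrib-* u _ p ⟩
      u ^ p * lookup (coords (pt (φ P))) i ^ p       ≈⟨ *-congˡ (coords-frobenius (φ P) i) ⟨
      u ^ p * lookup (coords (pt (frobenius (φ P)))) i ∎
    FFrobP = F-sends (frobenius P) λ v → F≉0 λ i →
      ^≈0⇒≈0 p (trans (sym (eval-^p (F∈𝔽ₚ i) (coords-frobenius P))) (v i))

  -- A triple of forms is encoded as one list of terms tagged with the index of the form
  -- they belong to, so that its coefficients make up a single vector.  The coefficient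
  -- stored in a term only records the original triple: form T k takes its own from k.
  Term : Set c
  Term = Fin 3 × Carrier × Vec ℕ 3

  exponents : Term → Vec ℕ 3
  exponents (_ , _ , es) = es

  coefficients : (T : List Term) → Fin (List.length T) → Carrier
  coefficients T k = proj₁ (proj₂ (List.lookup T k))

  δ : Fin 3 → Fin 3 → Carrier
  δ i j with i Fin.≟ j
  ... | yes _ = 1#
  ... | no  _ = 0#

  δ-^p : ∀ i j → δ i j ^ p ≈ δ i j
  δ-^p i j with i Fin.≟ j
  ... | yes _ = 1^n≈1 p
  ... | no  _ = 0^p≈0

  -- Every term appears in all three forms, with coefficient zero outside its own, so the evaluation
  -- is visibly linear in `k` by a single recursion on `T`.
  form : (T : List Term) → (Fin (List.length T) → Carrier) → Fin 3 → Poly 3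
  form []                 k i = []
  form ((j , _ , es) ∷ T) k i = (k zero * δ i j , es) ∷ form T (k ∘ suc) i

  form-cong : ∀ T {k k′} → (∀ n → k n ≈ k′ n) → ∀ i xs → eval (form T k i) xs ≈ eval (form T k′ i) xs
  form-cong []      e i xs = refl
  form-cong (_ ∷ T) e i xs = +-cong (*-congʳ (*-congʳ (e zero))) (form-cong T (e ∘ suc) i xs)

  form-0 : ∀ T i xs → eval (form T (λ _ → 0#) i) xs ≈ 0#
  form-0 []      i xs = refl
  form-0 (_ ∷ T) i xs = trans (+-cong (trans (*-congʳ (zeroˡ _)) (zeroˡ _)) (form-0 T i xs)) (+-identityˡ 0#)

  form-+ : ∀ T k k′ i xs → eval (form T (λ n → k n + k′ n) i) xs ≈ eval (form T k i) xs + eval (form T k′ i) xs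
  form-+ []      k k′ i xs = sym (+-identityˡ 0#)
  form-+ (_ ∷ T) k k′ i xs = trans (+-congˡ (form-+ T (k ∘ suc) (k′ ∘ suc) i xs))
    (solve 6 (λ k k′ d m f f′ → (k :+ k′) :* d :* m :+ (f :+ f′) := (k :* d :* m :+ f) :+ (k′ :* d :* m :+ f′))
      refl _ _ _ _ _ _)

  form-* : ∀ T u k i xs → eval (form T (λ n → u * k n) i) xs ≈ u * eval (form T k i) xs
  form-* []      u k i xs = sym (zeroʳ u)
  form-* (_ ∷ T) u k i xs = trans (+-congˡ (form-* T u (k ∘ suc) i xs))
    (solve 5 (λ u k d m f → u :* k :* d :* m :+ u :* f := u :* (k :* d :* m :+ f)) refl _ _ _ _ _)

  form-^p : ∀ T k i {xs ys} → (∀ j → lookup ys j ≈ lookup xs j ^ p) →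
    eval (form T (λ n → k n ^ p) i) ys ≈ eval (form T k i) xs ^ p
  form-^p []                 k i           e = sym 0^p≈0
  form-^p ((j , _ , es) ∷ T) k i {xs} {ys} e = begin
    k zero ^ p * δ i j * monomial es ys + eval (form T (λ n → k (suc n) ^ p) i) ys
      ≈⟨ +-cong (*-cong (*-congˡ (sym (δ-^p i j))) (monomial-^p es e)) (form-^p T (k ∘ suc) i e) ⟩
    k zero ^ p * δ i j ^ p * monomial es xs ^ p + eval (form T (k ∘ suc) i) xs ^ p
      ≈⟨ +-congʳ (trans (^-distrib-* _ _ p) (*-congʳ (^-distrib-* _ _ p))) ⟨
    (k zero * δ i j * monomial es xs) ^ p + eval (form T (k ∘ suc) i) xs ^ p
      ≈⟨ ^p-homo-+ _ _ ⟨
    (k zero * δ i j * monomial es xs + eval (form T (k ∘ suc) i) xs) ^ p ∎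

  form-homogeneous : ∀ {T d} → All (λ t → Vec.sum (exponents t) ≡ d) T → ∀ k i → Homogeneous d (form T k i)
  form-homogeneous []      k i = []
  form-homogeneous (e ∷ h) k i = e ∷ form-homogeneous h (k ∘ suc) i

  form-𝔽ₚ : ∀ T {k} → (∀ n → 𝔽ₚ (k n)) → ∀ i → CoefficientsIn 𝔽ₚ (form T k i)
  form-𝔽ₚ []                 k∈𝔽ₚ i = []
  form-𝔽ₚ ((j , _ , es) ∷ T) k∈𝔽ₚ i = times-δ (k∈𝔽ₚ zero) ∷ form-𝔽ₚ T (k∈𝔽ₚ ∘ suc) i
    where
    times-δ : ∀ {x} → 𝔽ₚ x → 𝔽ₚ (x * δ i j)
    times-δ (m , e) with i Fin.≟ j
    ... | yes _ = m , trans (*-identityʳ _) e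
    ... | no  _ = 0 , zeroʳ _

  tag : Fin 3 → Poly 3 → List Term
  tag j = List.map (j ,_)

  eval-tag : ∀ j f T i xs → eval (form (tag j f ++ T) (coefficients (tag j f ++ T)) i) xs ≈
    eval f xs * δ i j + eval (form T (coefficients T) i) xs
  eval-tag j []             T i xs = sym (trans (+-congʳ (zeroˡ _)) (+-identityˡ _))
  eval-tag j ((k , es) ∷ f) T i xs = trans (+-congˡ (eval-tag j f T i xs))
    (solve 5 (λ k d m f t → k :* d :* m :+ (f :* d :+ t) := (k :* m :+ f) :* d :+ t) refl _ _ _ _ _)

  terms : Vec (Poly 3) 3 → List Term
  terms (f ∷ g ∷ h ∷ []) = tag zero f ++ tag (suc zero) g ++ tag (suc (suc zero)) h ++ []

  eval-terms : ∀ F i xs → eval (form (terms F) (coefficients (terms F)) i) xs ≈ eval (lookup F i) xs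
  eval-terms (f ∷ g ∷ h ∷ []) i xs = trans
    (trans (eval-tag zero f _ i xs) (+-congˡ (trans (eval-tag (suc zero) g _ i xs)
      (+-congˡ (eval-tag (suc (suc zero)) h [] i xs)))))
    (select i)
    where
    select : ∀ i → eval f xs * δ i zero + (eval g xs * δ i (suc zero) + (eval h xs * δ i (suc (suc zero)) + 0#)) ≈
                   eval (lookup (f ∷ g ∷ h ∷ []) i) xs
    select zero             = solve 3 (λ f g h → f :* con 1 :+ (g :* con 0 :+ (h :* con 0 :+ con 0)) := f) refl _ _ _
    select (suc zero)       = solve 3 (λ f g h → f :* con 0 :+ (g :* con 1 :+ (h :* con 0 :+ con 0)) := g) refl _ _ _
    select (suc (suc zero)) = solve 3 (λ f g h → f :* con 0 :+ (g :* con 0 :+ (h :* con 1 :+ con 0)) := h) refl _ _ _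

  terms-homogeneous : ∀ {d} F → (∀ i → Homogeneous d (lookup F i)) → All (λ t → Vec.sum (exponents t) ≡ d) (terms F)
  terms-homogeneous (f ∷ g ∷ h ∷ []) hF = All.++⁺ (All.map⁺ (hF zero))
    (All.++⁺ (All.map⁺ (hF (suc zero))) (All.++⁺ (All.map⁺ (hF (suc (suc zero)))) []))

  module _ {E E′ : EllipticCurve} (φ : Isogeny E E′)
    (commutes : ∀ P → pt (map φ (frobenius P)) ≈ₚ pt (frobenius (map φ P))) where

    -- The coefficient vectors of the forms that represent φ; they are stable under
    -- Frobenius because φ commutes with it.
    representations : (T : List Term) → StableSubspace (List.length T) (c ⊔ ℓ)
    representations T = record
      { Member    = λ k → ∀ Q → ∃ λ u → ∀ i → eval (form T k i) (coords (pt Q)) ≈ u * lookup (coords (pt (map φ Q))) i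
      ; resp      = λ e F Q → proj₁ (F Q) , λ i → trans (sym (form-cong T e i _)) (proj₂ (F Q) i)
      ; 0-closed  = λ Q → 0# , λ i → trans (form-0 T i _) (sym (zeroˡ _))
      ; +-closed  = λ {F} {G} F∈ G∈ Q → proj₁ (F∈ Q) + proj₁ (G∈ Q) , λ i →
          trans (form-+ T F G i _) (trans (+-cong (proj₂ (F∈ Q) i) (proj₂ (G∈ Q) i)) (sym (distribʳ _ _ _)))
      ; *-closed  = λ k {F} F∈ Q → k * proj₁ (F∈ Q) , λ i →
          trans (form-* T k F i _) (trans (*-congˡ (proj₂ (F∈ Q) i)) (sym (*-assoc _ _ _)))
      -- `Q` is written as a Frobenius image of some `P`, since there the triple with p-th power
      -- coefficients takes the p-th powers of the values at `P`. The factor becomes `u ^ p`, and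
      -- `commutes` identifies the target with φ(Q).
      ; ^p-closed = λ {F} F∈ Q → let (P , FrobP≈Q) = frobenius-surjective Q ; (u , FP) = F∈ P in u ^ p , λ i → begin
          eval (form T (λ n → F n ^ p) i) (coords (pt Q))  ≈⟨ form-^p T F i (λ j →
                                                                trans (sym (coords-cong FrobP≈Q j)) (coords-frobenius P j)) ⟩
          eval (form T F i) (coords (pt P)) ^ p            ≈⟨ ^-congˡ p (FP i) ⟩
          (u * lookup (coords (pt (map φ P))) i) ^ p       ≈⟨ ^-distrib-* _ _ p ⟩
          u ^ p * lookup (coords (pt (map φ P))) i ^ p     ≈⟨ *-congˡ (coords-frobenius (map φ P) i) ⟨
          u ^ p * lookup (coords (pt (frobenius (map φ P)))) i
            ≈⟨ *-congˡ (coords-cong (≈ₚ-trans (≈ₚ-sym (commutes P)) (map-cong φ {frobenius P} {Q} FrobP≈Q)) i) ⟩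
          u ^ p * lookup (coords (pt (map φ Q))) i         ∎
      }

    -- If each rational member of the combination vanished at `xs`, so would `F`; decidable equality
    -- finds the first one that does not.
    nonvanishing-member : ∀ T {F} → RationalSpan (representations T) F → ∀ xs →
      ¬ (∀ i → eval (form T F i) xs ≈ 0#) →
      ∃ λ y → StableSubspace.Member (representations T) y × (∀ n → 𝔽ₚ (y n)) × ¬ (∀ i → eval (form T y i) xs ≈ 0#)
    nonvanishing-member T (none F≈0) xs F≉0 = contradiction (λ i → trans (form-cong T F≈0 i xs) (form-0 T i xs)) F≉0
    nonvanishing-member T (more d {y} {G} y∈ y∈𝔽ₚ G-span e) xs F≉0 with all? (λ i → eval (form T y i) xs ≟ 0#)
    ... | no  y≉0 = y , y∈ , y∈𝔽ₚ , y≉0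
    ... | yes y≈0 = nonvanishing-member T G-span xs λ G≈0 → F≉0 λ i → begin
      eval (form T _ i) xs                           ≈⟨ form-cong T e i xs ⟩
      eval (form T (λ n → d * y n + G n) i) xs       ≈⟨ form-+ T (λ n → d * y n) G i xs ⟩
      eval (form T (λ n → d * y n) i) xs + eval (form T G i) xs
                                                     ≈⟨ +-cong (trans (form-* T d y i xs) (*-congˡ (y≈0 i))) (G≈0 i) ⟩
      d * 0# + 0#                                    ≈⟨ trans (+-identityʳ _) (zeroʳ d) ⟩
      0#                                             ∎

    -- The rational triple has the exponents of the triple given at `P`, hence its degree; being a
    -- member, it represents φ at all points.
    commutes⇒definedOver-𝔽ₚ : DefinedOver 𝔽ₚ (map φ)
    commutes⇒definedOver-𝔽ₚ P with morphism φ P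
    ... | d , F , hF , _ , F≉0 , F-sends = rational (nonvanishing-member T (descent (representations T) F∈) (coords (pt P))
                                             λ v → F≉0 λ i → trans (sym (eval-terms F i _)) (v i))
      where
      T = terms F
      F∈ : StableSubspace.Member (representations T) (coefficients T)
      F∈ Q = let (u , FQ) = sends-everywhere (map φ) F F-sends Q in u , λ i → trans (eval-terms F i _) (FQ i)
      rational : (∃ λ y → StableSubspace.Member (representations T) y × (∀ n → 𝔽ₚ (y n)) ×
                   ¬ (∀ i → eval (form T y i) (coords (pt P)) ≈ 0#)) → _
      rational (y , y∈ , y∈𝔽ₚ , y≉0) = d , Vec.tabulate (form T y)
        , (λ i → ≡.subst (Homogeneous d) (≡.sym (look i)) (form-homogeneous (terms-homogeneous F hF) y i))
        , (λ i → ≡.subst (CoefficientsIn 𝔽ₚ) (≡.sym (look i)) (form-𝔽ₚ T y∈𝔽ₚ i))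
        , (λ v → y≉0 λ i → trans (reflexive (≡.cong (λ f → eval f (coords (pt P))) (≡.sym (look i)))) (v i))
        , λ Q _ → proj₁ (y∈ Q) , λ i →
            trans (reflexive (≡.cong (λ f → eval f (coords (pt Q))) (look i))) (proj₂ (y∈ Q) i)
        where
        look : ∀ i → lookup (Vec.tabulate (form T y)) i ≡ form T y i
        look = lookup∘tabulate (form T y)

  -- Rational functions and degrees

  at-cong : ∀ {E} (f : RationalFunction E) {P Q z} → P ≈ₚ Q → f at P ↦ z → f at Q ↦ z
  at-cong f {aff x y} {aff x′ y′} {z} (aff x≈x′ y≈y′) (den≉0 , e) =
      (λ den≈0 → den≉0 (trans (eval-cong den xy≈) den≈0))
    , trans (sym (eval-cong num xy≈)) (trans e (*-congˡ (eval-cong den xy≈)))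
    where
    open RationalFunction f using (num; den)
    xy≈ : ∀ i → lookup (x ∷ y ∷ []) i ≈ lookup (x′ ∷ y′ ∷ []) i
    xy≈ zero       = x≈x′
    xy≈ (suc zero) = y≈y′

  dehomogenise : Poly 3 → Poly 2
  dehomogenise = List.map λ { (k , a ∷ b ∷ _ ∷ []) → k , a ∷ b ∷ [] }

  eval-dehomogenise : ∀ f x y → eval (dehomogenise f) (x ∷ y ∷ []) ≈ eval f (x ∷ y ∷ 1# ∷ [])
  eval-dehomogenise []                         x y = refl
  eval-dehomogenise ((k , a ∷ b ∷ c ∷ []) ∷ f) x y =
    +-cong (*-congˡ (*-congˡ (*-congˡ (sym (trans (*-identityʳ _) (1^n≈1 c)))))) (eval-dehomogenise f x y)

  degreeBound : ∀ {n} → Poly n → ℕ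
  degreeBound = List.foldr (λ (_ , es) m → Vec.sum es ℕ.⊔ m) 0

  Bounded : ∀ {n} → ℕ → Poly n → Set c
  Bounded N = All λ (_ , es) → Vec.sum es ≤ N

  degreeBound-bounded : ∀ {n} (f : Poly n) → Bounded (degreeBound f) f
  degreeBound-bounded []             = []
  degreeBound-bounded ((k , es) ∷ f) = ℕ.m≤m⊔n _ _ ∷
    All.map (λ b → ℕ.≤-trans b (ℕ.m≤n⊔m (Vec.sum es) _)) (degreeBound-bounded f)

  -- The homogenising variable comes first.
  homogenise : ∀ {n} → ℕ → Poly n → Poly (suc n)
  homogenise N = List.map λ (k , es) → k , (N ℕ.∸ Vec.sum es) ∷ es

  homogeneous-homogenise : ∀ {n N} {f : Poly n} → Bounded N f → Homogeneous N (homogenise N f)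
  homogeneous-homogenise = All.map⁺ ∘ All.map ℕ.m∸n+n≡m

  eval-homogenise : ∀ {n} N (f : Poly n) xs → eval (homogenise N f) (1# ∷ xs) ≈ eval f xs
  eval-homogenise N []             xs = refl
  eval-homogenise N ((k , es) ∷ f) xs =
    +-cong (*-congˡ (trans (*-congʳ (1^n≈1 (N ℕ.∸ Vec.sum es))) (*-identityˡ _))) (eval-homogenise N f xs)

  -- f(F₀/F₂, F₁/F₂) F₂^{N+1}; the last factor F₂ makes it vanish wherever F₂ does.
  pullbackPoly : Vec (Poly 3) 3 → ℕ → Poly 2 → Poly 2
  pullbackPoly (F₀ ∷ F₁ ∷ F₂ ∷ []) N f = dehomogenise F₂ ⊗
    subst (homogenise N f) (dehomogenise F₂ ∷ dehomogenise F₀ ∷ dehomogenise F₁ ∷ [])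

  eval-pullbackPoly : ∀ F {N f x y X Y} → Bounded N f → ((u , _) : F sends aff x y to aff X Y) →
    eval (pullbackPoly F N f) (x ∷ y ∷ []) ≈ u ^ suc N * eval f (X ∷ Y ∷ [])
  eval-pullbackPoly (F₀ ∷ F₁ ∷ F₂ ∷ []) {N} {f} {x} {y} {X} {Y} bounded (u , FP) = begin
    eval (dehomogenise F₂ ⊗ g) (x ∷ y ∷ [])                        ≈⟨ eval-⊗ (dehomogenise F₂) g _ ⟩
    eval (dehomogenise F₂) (x ∷ y ∷ []) * eval g (x ∷ y ∷ [])      ≈⟨ *-cong Z (eval-subst (homogenise N f) G _) ⟩
    u * 1# * eval (homogenise N f) (evals G (x ∷ y ∷ []))          ≈⟨ *-cong (*-identityʳ u)
      (eval-scale (homogeneous-homogenise bounded) {evals G (x ∷ y ∷ [])} {1# ∷ X ∷ Y ∷ []} u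
        λ { zero → Z ; (suc zero) → trans (eval-dehomogenise F₀ x y) (FP zero)
          ; (suc (suc zero)) → trans (eval-dehomogenise F₁ x y) (FP (suc zero)) }) ⟩
    u * (u ^ N * eval (homogenise N f) (1# ∷ X ∷ Y ∷ []))          ≈⟨ *-assoc _ _ _ ⟨
    u ^ suc N * eval (homogenise N f) (1# ∷ X ∷ Y ∷ [])            ≈⟨ *-congˡ (eval-homogenise N f _) ⟩
    u ^ suc N * eval f (X ∷ Y ∷ [])                                ∎
    where
    G = dehomogenise F₂ ∷ dehomogenise F₀ ∷ dehomogenise F₁ ∷ []
    g = subst (homogenise N f) G
    Z : eval (dehomogenise F₂) (x ∷ y ∷ []) ≈ u * 1#
    Z = trans (eval-dehomogenise F₂ x y) (FP (suc (suc zero)))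

  pullbackPoly-O : ∀ F N f {x y} → F sends aff x y to O → eval (pullbackPoly F N f) (x ∷ y ∷ []) ≈ 0#
  pullbackPoly-O (F₀ ∷ F₁ ∷ F₂ ∷ []) N f {x} {y} (u , FP) = trans (eval-⊗ (dehomogenise F₂) _ _)
    (trans (*-congʳ (trans (eval-dehomogenise F₂ x y) (trans (FP (suc (suc zero))) (zeroʳ u)))) (zeroˡ _))

  -- The forms giving φ vary from point to point, so one fraction need not have a value wherever the
  -- composite does. This one uses the forms at `P`, and the value of `f` at φ(P) guarantees that
  -- its denominator is not zero on all of `E`.
  pullback : ∀ {E E′} (φ : Isogeny E E′) (f : RationalFunction E′) (P : Point E) → (∃ λ z → f at pt (map φ P) ↦ z) →
    ∃ λ (g : RationalFunction E) → (∀ Q z → g at pt Q ↦ z → f at pt (map φ Q) ↦ z) ×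
                                   (∀ z → f at pt (map φ P) ↦ z → g at pt P ↦ z)
  pullback φ f P@(O , _) (_ , e) with at-cong f (map-O φ) e
  ... | ()
  pullback {E} φ f P@(aff x y , x,y∈E) (z₀ , e₀) with morphism φ P
  ... | d , F , _ , _ , F≉0 , F-sends =
    g , drop , lift
    where
    open RationalFunction f using (num; den)
    -- A common bound, so that numerator and denominator acquire the same factor `u ^ suc N`, which
    -- then cancels.
    N = degreeBound (num ++ den)
    num-bounded : Bounded N num
    num-bounded = All.++⁻ˡ num (degreeBound-bounded (num ++ den))
    den-bounded : Bounded N den
    den-bounded = All.++⁻ʳ num (degreeBound-bounded (num ++ den))
    pull = pullbackPoly F N
    At : Carrier → Carrier → Carrier → Set ℓ
    At x y z = (¬ eval (pull den) (x ∷ y ∷ []) ≈ 0#) × eval (pull num) (x ∷ y ∷ []) ≈ z * eval (pull den) (x ∷ y ∷ [])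

    swap : ∀ w z d → w * (z * d) ≈ z * (w * d)
    swap w z d = solve 3 (λ w z d → w :* (z :* d) := z :* (w :* d)) refl w z d

    drop-at : ∀ {x y R z} → F sends aff x y to R → At x y z → f at R ↦ z
    -- Here the extra factor of `pullbackPoly` is essential: it makes the denominator vanish at
    -- points over `O`, where `f` has no value.
    drop-at {R = O}               FP                (den≉0 , _) = contradiction (pullbackPoly-O F N den FP) den≉0
    drop-at {R = aff X Y} {z = z} FP@(u , _) (den≉0 , e) =
        (λ den≈0 → den≉0 (trans den′ (trans (*-congˡ den≈0) (zeroʳ _))))
      , *-cancelˡ-≉0 (λ w≈0 → den≉0 (trans den′ (trans (*-congʳ w≈0) (zeroˡ _)))) (begin
          w * eval num (X ∷ Y ∷ [])          ≈⟨ eval-pullbackPoly F num-bounded FP ⟨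
          _                                  ≈⟨ e ⟩
          _                                  ≈⟨ *-congˡ den′ ⟩
          z * (w * eval den (X ∷ Y ∷ []))    ≈⟨ swap w z _ ⟨
          w * (z * eval den (X ∷ Y ∷ []))    ∎)
      where
      w = u ^ suc N
      den′ = eval-pullbackPoly F den-bounded FP

    lift-at : ∀ {R z} → F sends aff x y to R → f at R ↦ z → At x y z
    lift-at {aff X Y} {z} FP@(u , FP≈) (den≉0 , e) =
        (λ den≈0 → *-≉0 (^-≉0 (suc N) u≉0) den≉0 (trans (sym den′) den≈0))
      , (begin
          _                                  ≈⟨ eval-pullbackPoly F num-bounded FP ⟩
          w * eval num (X ∷ Y ∷ [])          ≈⟨ *-congˡ e ⟩
          w * (z * eval den (X ∷ Y ∷ []))    ≈⟨ swap w z _ ⟩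
          z * (w * eval den (X ∷ Y ∷ []))    ≈⟨ *-congˡ den′ ⟨
          _                                  ∎)
      where
      w = u ^ suc N
      den′ = eval-pullbackPoly F den-bounded FP
      u≉0 : ¬ u ≈ 0#
      u≉0 u≈0 = F≉0 λ i → trans (FP≈ i) (trans (*-congʳ u≈0) (zeroˡ _))

    g : RationalFunction E
    g = record { num = pull num ; den = pull den ; den≉0 = x , y , x,y∈E , proj₁ (lift-at (F-sends P F≉0) e₀) }

    drop : ∀ Q z → g at pt Q ↦ z → f at pt (map φ Q) ↦ z
    drop (O , _)         z ()
    drop Q@(aff x y , _) z at = drop-at (sends-everywhere (map φ) F F-sends Q) at

    lift : ∀ z → f at pt (map φ P) ↦ z → At x y z
    lift z = lift-at (F-sends P F≉0)

  witness : ∀ {E} (f : RationalFunction E) → ∃ λ (P : Point E) → ∃ λ z → f at pt P ↦ z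
  witness f with RationalFunction.den≉0 f
  ... | x , y , x,y∈E , den≉0 = (aff x y , x,y∈E) , n * d ⁻¹ , den≉0 , (begin
    n               ≈⟨ *-identityʳ n ⟨
    n * 1#          ≈⟨ *-congˡ (*-inverseʳ d den≉0) ⟨
    n * (d * d ⁻¹)  ≈⟨ solve 3 (λ n d i → n :* (d :* i) := n :* i :* d) refl n d (d ⁻¹) ⟩
    n * d ⁻¹ * d    ∎)
    where
    n = eval (RationalFunction.num f) (x ∷ y ∷ [])
    d = eval (RationalFunction.den f) (x ∷ y ∷ [])

  -- Degree and composition with an isomorphism

  module _ {E E′ E″} (φ : Isogeny E E′) (ψ : Isogeny E′ E″) (χ : Isogeny E″ E′)
    (χψ≈id : ∀ P → pt (map χ (map ψ P)) ≈ₚ pt P) (ψχ≈id : ∀ P → pt (map ψ (map χ P)) ≈ₚ pt P) where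

    -- The same `e` is a basis since ψ*, with inverse χ*, identifies the function fields of `E″` and
    -- `E′`, so the subfield of K(E) does not change. Generation moves the coefficients along χ*,
    -- independence along ψ*.
    isBasis-∘ : ∀ {n} {e : Fin n → RationalFunction E} → IsBasis φ e → IsBasis (ψ ∘ᵢ φ) e
    isBasis-∘ {n} {e} (generates , independent) = generates′ , independent′
      where
      pull-χ : (f : RationalFunction E′) → ∃ λ (g : RationalFunction E″) → ∀ Q z → g at pt Q ↦ z → f at pt (map χ Q) ↦ z
      pull-χ f with witness f
      ... | P , z , fP with pullback χ f (map ψ P) (z , at-cong f (≈ₚ-sym (χψ≈id P)) fP)
      ... | g , drop , _ = g , drop

      generates′ : ∀ f → ∃ λ g → Combination (ψ ∘ᵢ φ) g e f
      generates′ f with generates f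
      ... | g , combination = (λ i → proj₁ (pull-χ (g i))) , λ Q v w z gv ew fz → combination Q v w z
        (λ i → at-cong (g i) (χψ≈id (map φ Q)) (proj₂ (pull-χ (g i)) (map ψ (map φ Q)) (v i) (gv i))) ew fz

      independent′ : ∀ g → Relation (ψ ∘ᵢ φ) g e → ∀ i → IsZero (g i)
      independent′ g relation i R z₀ gR = independent (λ j → proj₁ (pull-ψ j))
        (λ Q v w gv → relation Q v w λ j → proj₁ (proj₂ (pull-ψ j)) (map φ Q) (v j) (gv j))
        i (map χ R) z₀ (proj₂ (proj₂ (pull-ψ i)) ≡.refl)
        where
        -- Each gⱼ is pulled back along a representation of ψ adapted to a point where
        -- gⱼ has a value; for gᵢ that point must be R.
        pull-ψ : ∀ j → ∃ λ (h : RationalFunction E′) →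
          (∀ Q z → h at pt Q ↦ z → g j at pt (map ψ Q) ↦ z) × (j ≡ i → h at pt (map χ R) ↦ z₀)
        pull-ψ j with j Fin.≟ i
        ... | yes ≡.refl with pullback ψ (g j) (map χ R) (z₀ , at-cong (g j) (≈ₚ-sym (ψχ≈id R)) gR)
        ...   | h , drop , lift = h , drop , λ _ → lift z₀ (at-cong (g j) (≈ₚ-sym (ψχ≈id R)) gR)
        pull-ψ j | no j≢i with witness (g j)
        ...   | P , z , gP with pullback ψ (g j) (map χ P) (z , at-cong (g j) (≈ₚ-sym (ψχ≈id P)) gP)
        ...     | h , drop , _ = h , drop , λ j≡i → contradiction j≡i j≢i

    hasDegree-∘ : ∀ {n} → HasDegree φ n → HasDegree (ψ ∘ᵢ φ) n
    hasDegree-∘ (inj₁ (n≡0 , φ≈O)) = inj₁ (n≡0 , λ P →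
      ≈ₚ-trans (map-cong ψ {map φ P} {O , tt} (φ≈O P)) (map-O ψ))
    hasDegree-∘ (inj₂ ((P , φP≉O) , e , basis)) = inj₂
      ( (P , λ ψφP≈O → φP≉O (≈ₚ-trans (≈ₚ-sym (χψ≈id (map φ P)))
          (≈ₚ-trans (map-cong χ {map ψ (map φ P)} {O , tt} ψφP≈O) (map-O χ))))
      , e , isBasis-∘ basis )

  -- Twisting

  negate-cong : ∀ {E E′} {P : Point E} {Q : Point E′} → pt P ≈ₚ pt Q → pt (negate P) ≈ₚ pt (negate Q)
  negate-cong {P = O       , _} {O         , _} O≈O         = O≈O
  negate-cong {P = aff _ _ , _} {aff _ _   , _} (aff ex ey) = aff ex (-‿cong ey)

  negate-involutive : ∀ {E} (P : Point E) → pt (negate (negate P)) ≈ₚ pt P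
  negate-involutive (O       , _) = O≈O
  negate-involutive (aff x y , _) = aff refl (-‿involutive y)

  module FlipProperties (p%4≡3 : p % 4 ≡ 3) {E E′ : EllipticCurve}
    (a′≈a : EllipticCurve.a E′ ≈ EllipticCurve.a E) (b′≈-b : EllipticCurve.b E′ ≈ - EllipticCurve.b E)
    {i} (i²≈-1 : i ^ 2 ≈ - 1#) where

    open Flip E E′ a′≈a b′≈-b i²≈-1

    flip-negate : ∀ P → pt (map flip (negate P)) ≈ₚ pt (negate (map flip P))
    flip-negate (O       , _) = O≈O
    flip-negate (aff x y , _) = aff refl (sym (-‿distribʳ-* i y))

    -- The sign comes from `i^p≈-i`, where `p ≡ 3 (mod 4)` enters; with `i ^ p ≈ i` the map would
    -- commute with Frobenius.
    flip-frobenius : ∀ P → pt (frobenius (map flip P)) ≈ₚ pt (negate (map flip (frobenius P)))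
    flip-frobenius (O       , _) = O≈O
    flip-frobenius (aff x y , _) = aff (^p-neg x) (begin
      (i * y) ^ p      ≈⟨ ^-distrib-* i y p ⟩
      i ^ p * y ^ p    ≈⟨ *-congʳ (i^p≈-i p%4≡3 i²≈-1) ⟩
      - i * y ^ p      ≈⟨ -‿distribˡ-* i _ ⟨
      - (i * y ^ p)    ∎)

    -- Two signs cancel: moving Frobenius past α gives one, moving it past the flip gives the other,
    -- and the flip carries negation to negation.
    flip-∘-twisting-commutes : (α : Isogeny E E) → Twisting α →
      ∀ P → pt (map flip (map α (frobenius P))) ≈ₚ pt (frobenius (map flip (map α P)))
    flip-∘-twisting-commutes α α-twisting P =
      ≈ₚ-trans (map-cong flip {map α (frobenius P)} {negate (frobenius (map α P))}
        (≈ₚ-trans (≈ₚ-sym (negate-involutive (map α (frobenius P))))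
                  (negate-cong {P = negate (map α (frobenius P))} {frobenius (map α P)} (≈ₚ-sym (α-twisting P)))))
      (≈ₚ-trans (flip-negate (frobenius (map α P))) (≈ₚ-sym (flip-frobenius (map α P))))

    flip-∘-commuting-twisting : (φ : Isogeny E′ E) → (∀ P → pt (map φ (frobenius P)) ≈ₚ pt (frobenius (map φ P))) →
      ∀ P → pt (frobenius (map flip (map φ P))) ≈ₚ pt (negate (map flip (map φ (frobenius P))))
    flip-∘-commuting-twisting φ φ-commutes P = ≈ₚ-trans (flip-frobenius (map φ P))
      (negate-cong {P = map flip (frobenius (map φ P))} {map flip (map φ (frobenius P))}
        (map-cong flip {frobenius (map φ P)} {map φ (frobenius P)} (≈ₚ-sym (φ-commutes P))))

  flip-inverse : ∀ {E E′ : EllipticCurve}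
    (a′≈a : EllipticCurve.a E′ ≈ EllipticCurve.a E) (b′≈-b : EllipticCurve.b E′ ≈ - EllipticCurve.b E)
    (a≈a′ : EllipticCurve.a E ≈ EllipticCurve.a E′) (b≈-b′ : EllipticCurve.b E ≈ - EllipticCurve.b E′)
    {i j} (i²≈-1 : i ^ 2 ≈ - 1#) (j²≈-1 : j ^ 2 ≈ - 1#) → j * i ≈ 1# → ∀ P →
    pt (map (Flip.flip E′ E a≈a′ b≈-b′ j²≈-1) (map (Flip.flip E E′ a′≈a b′≈-b i²≈-1) P)) ≈ₚ pt P
  flip-inverse a′≈a b′≈-b a≈a′ b≈-b′ i²≈-1 j²≈-1 ji≈1 (O       , _) = O≈O
  flip-inverse a′≈a b′≈-b a≈a′ b≈-b′ i²≈-1 j²≈-1 ji≈1 (aff x y , _) =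
    aff (-‿involutive x) (trans (sym (*-assoc _ _ _)) (trans (*-congʳ ji≈1) (*-identityˡ y)))

  module TwistIsomorphism (p%4≡3 : p % 4 ≡ 3) (E : EllipticCurve) where

    i = proj₁ i²≈-1
    i² = proj₂ i²≈-1

    -i² : (- i) ^ 2 ≈ - 1#
    -i² = trans (-x^2≈x^2 i) i²

    i*i≈-1 : i * i ≈ - 1#
    i*i≈-1 = trans (*-congˡ (sym (*-identityʳ i))) i²

    -i*i≈1 : - i * i ≈ 1#
    -i*i≈1 = trans (sym (-‿distribˡ-* i i)) (trans (-‿cong i*i≈-1) (-‿involutive 1#))

    i*-i≈1 : i * - i ≈ 1#
    i*-i≈1 = trans (*-comm i (- i)) -i*i≈1

    b≈--b : EllipticCurve.b E ≈ - (- EllipticCurve.b E)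
    b≈--b = sym (-‿involutive _)

    τ : Isogeny E (twist E)
    τ = Flip.flip E (twist E) refl refl i²

    τ⁻¹ : Isogeny (twist E) E
    -- `- i` is the inverse of `i`, and it is again a square root of -1.
    τ⁻¹ = Flip.flip (twist E) E refl b≈--b -i²

    τ⁻¹τ≈id : ∀ P → pt (map τ⁻¹ (map τ P)) ≈ₚ pt P
    τ⁻¹τ≈id = flip-inverse {E} {twist E} refl refl refl b≈--b i² -i² -i*i≈1

    ττ⁻¹≈id : ∀ P → pt (map τ (map τ⁻¹ P)) ≈ₚ pt P
    ττ⁻¹≈id = flip-inverse {twist E} {E} refl b≈--b refl refl -i² i² i*-i≈1

    twisting⇒isogeny : ∀ n → (∃ λ (α : Isogeny E E) → Twisting α × HasDegree α n) →
      ∃₂ λ (E′ : EllipticCurve) (φ : Isogeny E E′) → DefinedOver 𝔽ₚ (map φ) × HasDegree φ n × (E′ ≅𝔽ₚ twist E)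
    twisting⇒isogeny n (α , α-twisting , α-degree) = twist E , τ ∘ᵢ α
      , commutes⇒definedOver-𝔽ₚ (τ ∘ᵢ α) (FlipProperties.flip-∘-twisting-commutes p%4≡3 {E} {twist E} refl refl i² α α-twisting)
      , hasDegree-∘ α τ τ⁻¹ τ⁻¹τ≈id ττ⁻¹≈id α-degree
      , idᵢ , idᵢ , id-def , id-def , (λ P → ≈ₚ-refl) , λ P → ≈ₚ-refl
      where
      id-def : DefinedOver 𝔽ₚ (id {A = Point (twist E)})
      id-def = identity-definedOver (1 , sym (+-identityʳ 1#))

    -- `f ∘ᵢ φ` lands in the twist and commutes with Frobenius because both factors are defined over
    -- 𝔽ₚ; the one remaining sign comes from `τ⁻¹`.
    isogeny⇒twisting : ∀ n →
      (∃₂ λ (E′ : EllipticCurve) (φ : Isogeny E E′) → DefinedOver 𝔽ₚ (map φ) × HasDegree φ n × (E′ ≅𝔽ₚ twist E)) →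
      ∃ λ (α : Isogeny E E) → Twisting α × HasDegree α n
    isogeny⇒twisting n (E′ , φ , φ-𝔽ₚ , φ-degree , f , g , f-𝔽ₚ , _ , gf≈id , fg≈id) = τ⁻¹ ∘ᵢ f ∘ᵢ φ
      , FlipProperties.flip-∘-commuting-twisting p%4≡3 {twist E} {E} refl b≈--b -i² (f ∘ᵢ φ) fφ-commutes
      , hasDegree-∘ (f ∘ᵢ φ) τ⁻¹ τ ττ⁻¹≈id τ⁻¹τ≈id (hasDegree-∘ φ f g gf≈id fg≈id φ-degree)
      where
      fφ-commutes : ∀ P → pt (map f (map φ (frobenius P))) ≈ₚ pt (frobenius (map f (map φ P)))
      fφ-commutes P = ≈ₚ-trans (map-cong f {map φ (frobenius P)} {frobenius (map φ P)}
                                 (definedOver-𝔽ₚ⇒commutes {φ = map φ} φ-𝔽ₚ P))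
                               (definedOver-𝔽ₚ⇒commutes {φ = map f} f-𝔽ₚ (map φ P))

theorem3p10 : ∀ {c ℓ : Level} (p : ℕ) (p-prime : Prime p) → p > 3 → p % 4 ≡ 3 →
  (K : AlgebraicClosure p c ℓ) →
  let open AlgebraicClosure K
      open Curves p-prime K
  in
  (n : ℕ) → n ≥ 1 →
  (E : EllipticCurve) → Supersingular E → ¬ (j E ≈ (1728 · 1#)) →
  (∃ λ (α : Isogeny E E) → Twisting α × HasDegree α n)
    ⇔
  (∃₂ λ (E′ : EllipticCurve) (φ : Isogeny E E′) →
    DefinedOver 𝔽ₚ (map φ) × HasDegree φ n × (E′ ≅𝔽ₚ twist E))
theorem3p10 p p-prime _ p%4≡3 K n _ E _ _ = mk⇔ (twisting⇒isogeny n) (isogeny⇒twisting n)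
  where open Twists.TwistIsomorphism p-prime K p%4≡3 E
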